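{- There is an algorithm that, given an instance $(G=(V,E,w),A,X)$ of Effectors-Cost and a node $v\in V$, computes the probability $p(v|X)$ in $O(2^r\cdot n(n+m))$ time, where $n=|V|$, $m=|E|$ and $r=|\{u\to v\in E: w(u\to v)<1\}|$ is the number of probabilistic arcs. Accordingly, Effectors-Cost can be solved in $O(2^r\cdot n^2(n+m))$ time.
   Context: An influence graph $G=(V,E,w)$ is a finite simple directed graph (no loops) with a weight function $w:E\to(0,1]\cap\mathbb{Q}$. Independent Cascade process started from $X\subseteq V$: at time $0$ exactly the nodes in $X$ are active. When a node $u$ becomes active for the first time, at time step $t$, it gets a single chance to activate each currently inactive out-neighbor $v$, succeeding with probability $w(u\to v)$, all attempts being independent; if it succeeds, $v$ becomes active at step $t+1$; if it fails, $u$ makes no further attempts on $v$. Active nodes stay active. The process terminates when there are no newly activated nodes. Let $p(v|X)$ be the probability that $v$ is active upon termination. Cost: for $A\subseteq V$ and $X\subseteq V$, $C_A(G,X):=\sum_{v\in A}(1-p(v|X))+\sum_{v\in V\setminus A}p(v|X)$. Effectors-Cost: given an influence graph $G=(V,E,w)$, a set of target nodes $A\subseteq V$, and a set of effectors $X\subseteq V$, compute $C_A(G,X)$. Running-time convention: the precision of the probabilities given by $w$ is polynomially bounded in $n$, and additions and multiplications of rational numbers are assumed to take constant time. -}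

module Defs where

open import Data.Bool.Base using (Bool; true; false; not; _∧_; if_then_else_)
open import Data.Empty using (⊥-elim)
open import Data.Fin.Base using (Fin; toℕ; fromℕ<)
open import Data.Fin.Subset using (Subset; _∈_; _∉_; _∪_; ∁; ⁅_⁆; ∣_∣; Empty) renaming (⊥ to ∅)
open import Data.Fin.Subset.Properties using (_∈?_; nonempty?; ∉⊥; x∈p∪q⁻; x∈⁅y⁆⇒x≡y; p⊆p∪q; q⊆p∪q; p⊂q⇒∣p∣<∣q∣; ∣p∣≤n; x∈p⇒∣p-x∣<∣p∣)
open import Data.List.Base using (List; []; _∷_; allFin; filter; foldr; length; map)
open import Data.Nat.Base using (ℕ; zero; suc; _+_; _*_; _∸_; _⊔_; _≤_; _<_; z≤n)
import Data.Nat.Properties as ℕ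
open import Data.Product.Base using (_×_; _,_; proj₁; proj₂; ∃-syntax; Σ-syntax)
open import Data.Rational.Base as ℚ using (ℚ; 0ℚ; 1ℚ)
import Data.Rational.Properties as ℚ
open import Data.Sum.Base using (inj₁; inj₂)
open import Relation.Binary.PropositionalEquality using (_≡_; _≢_; subst; sym)
open import Relation.Nullary using (yes; no; does)

-- The nodes are Fin n and the arc set is enumerated, in an arbitrary order,
-- by Fin m.
record InfluenceGraph (n : ℕ) : Set where
  field
    m        : ℕ
    src tgt  : Fin m → Fin n
    simple   : ∀ {e f} → src e ≡ src f → tgt e ≡ tgt f → e ≡ f
    loopless : ∀ e → src e ≢ tgt e
    w        : Fin m → ℚ
    0<w      : ∀ e → 0ℚ ℚ.< w e
    w≤1      : ∀ e → w e ℚ.≤ 1ℚ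

  probabilisticArcs : List (Fin m)
  probabilisticArcs = filter (λ e → w e ℚ.<? 1ℚ) (allFin m)

  r : ℕ
  r = length probabilisticArcs

-- flip p k tosses a fresh coin, independent of all others, that shows true
-- with probability p, and continues as k prescribes.
data Random (A : Set) : Set where
  return : A → Random A
  flip   : ℚ → (Bool → Random A) → Random A

infixl 1 _>>=_

_>>=_ : ∀ {A B} → Random A → (A → Random B) → Random B
return a >>= f = f a
flip p k >>= f = flip p (λ b → k b >>= f)

Pr : ∀ {A} → (A → Bool) → Random A → ℚ
Pr P (return a) = if P a then 1ℚ else 0ℚ
Pr P (flip p k) = p ℚ.* Pr P (k true) ℚ.+ (1ℚ ℚ.- p) ℚ.* Pr P (k false)

data AllOutcomes {A : Set} (P : A → Set) : Random A → Set where
  return : ∀ {a} → P a → AllOutcomes P (return a)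
  flip   : ∀ {p k} → (∀ b → AllOutcomes P (k b)) → AllOutcomes P (flip p k)

bindAll : ∀ {A B} {P : A → Set} {Q : B → Set} {x : Random A} {f : A → Random B} →
          AllOutcomes P x → (∀ {a} → P a → AllOutcomes Q (f a)) → AllOutcomes Q (x >>= f)
bindAll (return p) g = g p
bindAll (flip ps)  g = flip (λ b → bindAll (ps b) g)

-- fresh is the set of nodes that became active at the current time step.
record Cascade (n : ℕ) : Set where
  constructor cascade
  field
    active fresh : Subset n

open Cascade public

module _ {n : ℕ} (G : InfluenceGraph n) where
  open InfluenceGraph G

  start : Subset n → Cascade n
  start X = cascade X X

  -- Only arcs from fresh nodes to nodes inactive at the start of the time
  -- step carry an attempt; several attempts may hit the same node.
  attempts : List (Fin m) → Cascade n → Random (Subset n)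
  attempts []       s = return ∅
  attempts (e ∷ es) s =
    if does (src e ∈? fresh s) ∧ not (does (tgt e ∈? active s))
    then (flip (w e) λ success →
          attempts es s >>= λ hit →
          return (if success then ⁅ tgt e ⁆ ∪ hit else hit))
    else attempts es s

  step : Cascade n → Random (Cascade n)
  step s = attempts (allFin m) s >>= λ hit → return (cascade (active s ∪ hit) hit)

  run : ℕ → Cascade n → Random (Cascade n)
  run zero    s = return s
  run (suc t) s = step s >>= run t

  -- By time n the process has terminated (see terminated below), and a
  -- terminated process does not change any more.
  p : Subset n → Fin n → ℚ
  p X v = Pr (λ s → does (v ∈? active s)) (run n (start X))

  ∑[_] : Subset n → (Fin n → ℚ) → ℚ
  ∑[ S ] f = foldr ℚ._+_ 0ℚ (map f (filter (_∈? S) (allFin n)))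

  C : Subset n → Subset n → ℚ
  C A X = ∑[ A ] (λ v → 1ℚ ℚ.- p X v) ℚ.+ ∑[ ∁ A ] (λ v → p X v)

  Sound : Cascade n → Subset n → Set
  Sound s hit = ∀ {v} → v ∈ hit → v ∉ active s × (∃[ u ] u ∈ fresh s)

  attempts-sound : ∀ es s → AllOutcomes (Sound s) (attempts es s)
  attempts-sound []       s = return (λ v∈∅ → ⊥-elim (∉⊥ v∈∅))
  attempts-sound (e ∷ es) s with src e ∈? fresh s | tgt e ∈? active s
  ... | no  _    | _        = attempts-sound es s
  ... | yes _    | yes _    = attempts-sound es s
  ... | yes src∈ | no  tgt∉ = flip outcome
    where
    add : ∀ {hit} → Sound s hit → Sound s (⁅ tgt e ⁆ ∪ hit)
    add {hit} h v∈ with x∈p∪q⁻ ⁅ tgt e ⁆ hit v∈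
    ... | inj₁ v∈⁅⁆  = subst (_∉ active s) (sym (x∈⁅y⁆⇒x≡y _ v∈⁅⁆)) tgt∉ , _ , src∈
    ... | inj₂ v∈hit = h v∈hit

    outcome : ∀ b → AllOutcomes (Sound s)
      (attempts es s >>= λ hit → return (if b then ⁅ tgt e ⁆ ∪ hit else hit))
    outcome true  = bindAll (attempts-sound es s) (λ h → return (add h))
    outcome false = bindAll (attempts-sound es s) (λ h → return h)

  run-terminated : ∀ t s → Empty (fresh s) → AllOutcomes (λ s′ → Empty (fresh s′)) (run t s)
  run-terminated zero    s ∄ = return ∄
  run-terminated (suc t) s ∄ =
    bindAll (bindAll (attempts-sound (allFin m) s) (λ h → return λ (_ , v∈) → ∄ (proj₂ (h v∈))))
            (run-terminated t _)

  run-terminates : ∀ t s → n < t + ∣ active s ∣ → AllOutcomes (λ s′ → Empty (fresh s′)) (run t s)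
  run-terminates zero    s n< = ⊥-elim (ℕ.<⇒≱ n< (∣p∣≤n (active s)))
  run-terminates (suc t) s n< =
    bindAll {P = λ s′ → AllOutcomes (λ s″ → Empty (fresh s″)) (run t s′)}
      (bindAll (attempts-sound (allFin m) s) (λ {hit} h → return (next hit h)))
      (λ x → x)
    where
    next : ∀ hit → Sound s hit →
           AllOutcomes (λ s′ → Empty (fresh s′)) (run t (cascade (active s ∪ hit) hit))
    next hit h with nonempty? hit
    ... | no  ∄        = run-terminated t _ ∄
    ... | yes (v , v∈) = run-terminates t _ (ℕ.≤-trans n<
            (subst (_≤ t + ∣ active s ∪ hit ∣) (ℕ.+-suc t ∣ active s ∣)
              (ℕ.+-monoʳ-≤ t (p⊂q⇒∣p∣<∣q∣
                (p⊆p∪q hit , v , q⊆p∪q (active s) hit v∈ , proj₁ (h v∈))))))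

  terminated : ∀ X → AllOutcomes (λ s → Empty (fresh s)) (run n (start X))
  terminated X with nonempty? X
  ... | no  ∄        = run-terminated n _ ∄
  ... | yes (v , v∈) = run-terminates n _
          (ℕ.m<m+n n (ℕ.≤-<-trans z≤n (x∈p⇒∣p-x∣<∣p∣ v∈)))

record EffectorsInstance : Set where
  field
    n   : ℕ
    G   : InfluenceGraph n
    A X : Subset n

  open InfluenceGraph G public using (m; r)

-- The machine model: while programs over finitely many (as many as occur in
-- the program) unbounded arrays of naturals and of rationals, named by
-- naturals.  A scalar variable is cell 0 of an array.  Each arithmetic
-- operation, comparison, constant, array access and command costs one unit.

infixl 6 _⊕_ _⊖_
infixl 7 _⊗_
infix  5 _≺_ _≺ᵣ_

data Exp : Set where
  lit     : ℕ → Exp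
  get     : ℕ → Exp → Exp
  _⊕_ _⊖_ : Exp → Exp → Exp

data RatExp : Set where
  lit     : ℚ → RatExp
  get     : ℕ → Exp → RatExp
  _⊕_ _⊗_ : RatExp → RatExp → RatExp

data Test : Set where
  _≺_  : Exp → Exp → Test
  _≺ᵣ_ : RatExp → RatExp → Test

infixr 3 _⨾_

data Program : Set where
  skip          : Program
  set           : ℕ → Exp → Exp → Program
  setᵣ          : ℕ → Exp → RatExp → Program
  _⨾_           : Program → Program → Program
  ifᵖ_then_else_ : Test → Program → Program → Program
  while_run_    : Test → Program → Program

record Store : Set where
  constructor store
  field
    nat : ℕ → ℕ → ℕ
    rat : ℕ → ℕ → ℚ

open Store public

update : {A : Set} → ℕ → ℕ → A → (ℕ → ℕ → A) → ℕ → ℕ → A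
update a i x f b j = if does (b ℕ.≟ a) ∧ does (j ℕ.≟ i) then x else f b j

⟦_⟧ : Exp → Store → ℕ
⟦ lit k   ⟧ σ = k
⟦ get a x ⟧ σ = nat σ a (⟦ x ⟧ σ)
⟦ x ⊕ y   ⟧ σ = ⟦ x ⟧ σ + ⟦ y ⟧ σ
⟦ x ⊖ y   ⟧ σ = ⟦ x ⟧ σ ∸ ⟦ y ⟧ σ

⟦_⟧ᵣ : RatExp → Store → ℚ
⟦ lit q   ⟧ᵣ σ = q
⟦ get a x ⟧ᵣ σ = rat σ a (⟦ x ⟧ σ)
⟦ x ⊕ y   ⟧ᵣ σ = ⟦ x ⟧ᵣ σ ℚ.+ ⟦ y ⟧ᵣ σ
⟦ x ⊗ y   ⟧ᵣ σ = ⟦ x ⟧ᵣ σ ℚ.* ⟦ y ⟧ᵣ σ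

⟦_⟧ₜ : Test → Store → Bool
⟦ x ≺  y ⟧ₜ σ = does (⟦ x ⟧ σ ℕ.<? ⟦ y ⟧ σ)
⟦ x ≺ᵣ y ⟧ₜ σ = does (⟦ x ⟧ᵣ σ ℚ.<? ⟦ y ⟧ᵣ σ)

cost : Exp → ℕ
cost (lit k)   = 1
cost (get a x) = suc (cost x)
cost (x ⊕ y)   = suc (cost x + cost y)
cost (x ⊖ y)   = suc (cost x + cost y)

costᵣ : RatExp → ℕ
costᵣ (lit q)   = 1
costᵣ (get a x) = suc (cost x)
costᵣ (x ⊕ y)   = suc (costᵣ x + costᵣ y)
costᵣ (x ⊗ y)   = suc (costᵣ x + costᵣ y)

costₜ : Test → ℕ
costₜ (x ≺  y) = suc (cost x + cost y)
costₜ (x ≺ᵣ y) = suc (costᵣ x + costᵣ y)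

infix 2 ⟨_,_⟩⇓⟨_,_⟩

-- ⟨ P , σ ⟩⇓⟨ σ′ , t ⟩: started in σ, P halts in σ′ after t units of time.
data ⟨_,_⟩⇓⟨_,_⟩ : Program → Store → Store → ℕ → Set where
  skip : ∀ {σ} → ⟨ skip , σ ⟩⇓⟨ σ , 1 ⟩

  set : ∀ {a i x σ} →
    ⟨ set a i x , σ ⟩⇓⟨ store (update a (⟦ i ⟧ σ) (⟦ x ⟧ σ) (nat σ)) (rat σ) , suc (cost i + cost x) ⟩

  setᵣ : ∀ {a i x σ} →
    ⟨ setᵣ a i x , σ ⟩⇓⟨ store (nat σ) (update a (⟦ i ⟧ σ) (⟦ x ⟧ᵣ σ) (rat σ)) , suc (cost i + costᵣ x) ⟩

  _⨾_ : ∀ {P Q σ σ′ σ″ t u} →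
    ⟨ P , σ ⟩⇓⟨ σ′ , t ⟩ → ⟨ Q , σ′ ⟩⇓⟨ σ″ , u ⟩ → ⟨ P ⨾ Q , σ ⟩⇓⟨ σ″ , t + u ⟩

  if-true : ∀ {b P Q σ σ′ t} → ⟦ b ⟧ₜ σ ≡ true →
    ⟨ P , σ ⟩⇓⟨ σ′ , t ⟩ → ⟨ ifᵖ b then P else Q , σ ⟩⇓⟨ σ′ , suc (costₜ b + t) ⟩

  if-false : ∀ {b P Q σ σ′ t} → ⟦ b ⟧ₜ σ ≡ false →
    ⟨ Q , σ ⟩⇓⟨ σ′ , t ⟩ → ⟨ ifᵖ b then P else Q , σ ⟩⇓⟨ σ′ , suc (costₜ b + t) ⟩

  while-true : ∀ {b P σ σ′ σ″ t u} → ⟦ b ⟧ₜ σ ≡ true →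
    ⟨ P , σ ⟩⇓⟨ σ′ , t ⟩ → ⟨ while b run P , σ′ ⟩⇓⟨ σ″ , u ⟩ →
    ⟨ while b run P , σ ⟩⇓⟨ σ″ , suc (costₜ b + t + u) ⟩

  while-false : ∀ {b P σ} → ⟦ b ⟧ₜ σ ≡ false →
    ⟨ while b run P , σ ⟩⇓⟨ σ , suc (costₜ b) ⟩

tabulated : {A : Set} {k : ℕ} → A → (Fin k → A) → ℕ → A
tabulated {k = k} default f i with i ℕ.<? k
... | yes i<k = f (fromℕ< i<k)
... | no  _   = default

bit : Bool → ℕ
bit b = if b then 1 else 0

-- Natural arrays: 0 holds n, m and the query in cells 0, 1 and 2; 1 and 2 hold
-- the sources and targets of the arcs; 3 and 4 the characteristic vectors of A
-- and X.  Rational array 0 holds the weights.  All other cells are zero.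
encodeWith : EffectorsInstance → ℕ → Store
encodeWith I query = store nats rats
  where
  open EffectorsInstance I
  open InfluenceGraph G using (src; tgt; w)

  nats : ℕ → ℕ → ℕ
  nats 0 0 = n
  nats 0 1 = m
  nats 0 2 = query
  nats 1   = tabulated 0 (λ e → toℕ (src e))
  nats 2   = tabulated 0 (λ e → toℕ (tgt e))
  nats 3   = tabulated 0 (λ v → bit (does (v ∈? A)))
  nats 4   = tabulated 0 (λ v → bit (does (v ∈? X)))
  nats _ _ = 0

  rats : ℕ → ℕ → ℚ
  rats 0   = tabulated 0ℚ w
  rats _ _ = 0ℚ

NodeQuery : Set
NodeQuery = Σ[ I ∈ EffectorsInstance ] Fin (EffectorsInstance.n I)

encodeNodeQuery : NodeQuery → Store
encodeNodeQuery (I , v) = encodeWith I (toℕ v)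

encode : EffectorsInstance → Store
encode I = encodeWith I 0

output : Store → ℚ
output σ = rat σ 1 0

activationProbability : NodeQuery → ℚ
activationProbability (I , v) = p G X v
  where open EffectorsInstance I

effectorsCost : EffectorsInstance → ℚ
effectorsCost I = C G A X
  where open EffectorsInstance I

-- One program computes f on all inputs, in time O(T).  The maximum with 1
-- only matters where T vanishes, i.e. below for the graph without nodes.
ComputableInTimeO : {Input : Set} → (Input → Store) → (Input → ℚ) → (Input → ℕ) → Set
ComputableInTimeO {Input} enc f T =
  ∃[ P ] ∃[ c ] ((x : Input) →
    ∃[ σ ] ∃[ t ] (⟨ P , enc x ⟩⇓⟨ σ , t ⟩ × output σ ≡ f x × t ≤ c * (1 ⊔ T x)))

{-# OPTIONS --safe #-}
module Submission where

-- A node is fresh at only one time step, so each arc is attempted at most once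
-- and its coin may be tossed before the process starts (run-𝔼). Hence p(v|X) is
-- the probability that v is reachable from X within n steps along arcs whose
-- coin shows true, and only r of the coins are random. The algorithm sums over
-- their 2 ^ r outcomes; for each one, n rounds of inspecting all arcs find the
-- reachable nodes in time O(n(n + m)).

open import Defs
open import Data.Bool.Base using (Bool; true; false; not; _∧_; if_then_else_)
open import Data.Empty using (⊥-elim)
open import Data.Fin.Base as Fin using (Fin; toℕ; fromℕ<)
import Data.Fin.Properties as Fin
open import Data.Fin.Subset using (Subset; _∈_; _∉_; _∪_; ∁; ⁅_⁆) renaming (⊥ to ∅)
open import Data.Fin.Subset.Properties using (_∈?_; ∉⊥; x∈p∪q⁻; x∈p∪q⁺; x∈⁅x⁆; x∈⁅y⁆⇒x≡y; x∈∁p⇒x∉p; x∉p⇒x∈∁p)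
open import Data.List.Base using (List; []; _∷_; allFin; filter; foldr; length; map; tabulate)
open import Data.List.Membership.Propositional using () renaming (_∈_ to _∈ˡ_)
open import Data.List.Membership.Propositional.Properties using (∈-allFin)
import Data.List.Relation.Unary.All as All
open import Data.List.Relation.Unary.AllPairs using (_∷_)
open import Data.List.Relation.Unary.Any using (here; there)
open import Data.List.Relation.Unary.Unique.Propositional using (Unique)
open import Data.List.Relation.Unary.Unique.Propositional.Properties using (allFin⁺)
open import Data.Nat.Base using (ℕ; zero; suc; _+_; _*_; _∸_; _^_; _⊔_; _≤_; _<_; z≤n; s≤s)
import Data.Nat.Properties as ℕ
import Data.Nat.Solver as ℕ
open import Data.Product.Base using (_×_; _,_; proj₁; proj₂; ∃-syntax)
open import Data.Rational.Base as ℚ using (ℚ; 0ℚ; 1ℚ)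
import Data.Rational.Properties as ℚ
open import Data.Rational.Solver using (module +-*-Solver)
open import Data.Sum.Base using (_⊎_; inj₁; inj₂; [_,_]′)
open import Function.Base using (_∘_; id)
open import Relation.Binary.PropositionalEquality hiding (J)
open import Relation.Nullary using (Dec; yes; no; does; ¬_; contradiction)
open import Relation.Nullary.Decidable using (dec-true; dec-false)

open +-*-Solver using (solve; con; _:+_; _:*_; _:-_; :-_; _:=_)
module ℕSolver = ℕ.+-*-Solver

-- Tossing a coin early changes nothing only if no one else looks at it: neither another attempt of
-- the same time step nor the rest of the process. The second condition is the delicate one. It
-- rests on the fact that new hits avoid the active nodes, and it travels through the proof as a
-- restriction on the hits (`Disjoint`) and on the continuation (`Ignores`). On the machine, the
-- obstacle is to list the outcomes when naturals can only be added, subtracted and compared. The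
-- number of an outcome is therefore decoded against a table that holds, for each `k`, how many
-- outcomes the first `k` coins have. This costs O(m) per outcome, which the simulation dominates.
-- The process, the reachability relation and the rounds of the simulation share one clock, so they
-- are compared time step by time step. To make this exact, every round reads a snapshot of the
-- marks and writes to another array.

ind : Bool → ℚ
ind b = if b then 1ℚ else 0ℚ

-- The machine does not subtract rationals; its programs compute the left-hand side.
complement : ∀ q → 1ℚ ℚ.+ (ℚ.- 1ℚ) ℚ.* q ≡ 1ℚ ℚ.- q
complement = solve 1 (λ q → con 1ℚ :+ (:- con 1ℚ) :* q := con 1ℚ :- q) refl

average : ∀ q a → q ℚ.* a ℚ.+ (1ℚ ℚ.- q) ℚ.* a ≡ a
average = solve 2 (λ q a → q :* a :+ (con 1ℚ :- q) :* a := a) refl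

-- Finite sums of rationals

-- Splitting off the largest index suits loops that count down: while index `k` is being processed,
-- `sum k f` is what remains.
sum : ℕ → (ℕ → ℚ) → ℚ
sum zero    f = 0ℚ
sum (suc k) f = f k ℚ.+ sum k f

sum-cong : ∀ k {f g} → (∀ j → j < k → f j ≡ g j) → sum k f ≡ sum k g
sum-cong zero    f≡g = refl
sum-cong (suc k) f≡g =
  cong₂ ℚ._+_ (f≡g k ℕ.≤-refl) (sum-cong k λ j j<k → f≡g j (ℕ.m<n⇒m<1+n j<k))

sum-split : ∀ k l f → sum (k + l) f ≡ sum k (λ j → f (l + j)) ℚ.+ sum l f
sum-split zero    l f = sym (ℚ.+-identityˡ _)
sum-split (suc k) l f = trans
  (cong₂ ℚ._+_ (cong f (ℕ.+-comm k l)) (sum-split k l f))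
  (sym (ℚ.+-assoc (f (l + k)) _ _))

sum-*ˡ : ∀ k c f → sum k (λ j → c ℚ.* f j) ≡ c ℚ.* sum k f
sum-*ˡ zero    c f = sym (ℚ.*-zeroʳ c)
sum-*ˡ (suc k) c f = trans (cong (c ℚ.* f k ℚ.+_) (sum-*ˡ k c f))
  (sym (ℚ.*-distribˡ-+ c (f k) (sum k f)))

sum-first : ∀ k f → sum (suc k) f ≡ f 0 ℚ.+ sum k (f ∘ suc)
sum-first zero    f = refl
sum-first (suc k) f = begin
  f (suc k) ℚ.+ sum (suc k) f                  ≡⟨ cong (f (suc k) ℚ.+_) (sum-first k f) ⟩
  f (suc k) ℚ.+ (f 0 ℚ.+ sum k (f ∘ suc))      ≡⟨ solve 3 (λ a b c → a :+ (b :+ c) := b :+ (a :+ c)) refl (f (suc k)) (f 0) (sum k (f ∘ suc)) ⟩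
  f 0 ℚ.+ (f (suc k) ℚ.+ sum k (f ∘ suc))      ∎
  where open ≡-Reasoning

tabulated-toℕ : ∀ {A : Set} {k} (d : A) (f : Fin k → A) i → tabulated d f (toℕ i) ≡ f i
tabulated-toℕ {k = k} d f i with toℕ i ℕ.<? k
... | yes i<k = cong f (Fin.fromℕ<-toℕ i i<k)
... | no  i≮k = contradiction (Fin.toℕ<n i) i≮k

sum-allFin : ∀ {k} {A : Set} (h : A → ℚ) (f : Fin k → A) (g : ℕ → ℚ) →
  (∀ i → g (toℕ i) ≡ h (f i)) → foldr ℚ._+_ 0ℚ (map h (tabulate f)) ≡ sum k g
sum-allFin {zero}  h f g g≡ = refl
sum-allFin {suc k} h f g g≡ = trans
  (cong₂ ℚ._+_ (sym (g≡ Fin.zero)) (sum-allFin h (f ∘ Fin.suc) (g ∘ suc) (g≡ ∘ Fin.suc)))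
  (sym (sum-first k g))

-- Independent coins and the enumeration of their outcomes

Coins : Set
Coins = ℕ → Bool

_[_≔_] : ∀ {A : Set} → (ℕ → A) → ℕ → A → ℕ → A
(ω [ k ≔ b ]) i = if does (i ℕ.≟ k) then b else ω i

≔-same : ∀ {A : Set} (ω : ℕ → A) k b → (ω [ k ≔ b ]) k ≡ b
≔-same ω k b rewrite dec-true (k ℕ.≟ k) refl = refl

≔-other : ∀ {A : Set} (ω : ℕ → A) {k} b {i} → i ≢ k → (ω [ k ≔ b ]) i ≡ ω i
≔-other ω {k} b {i} i≢k rewrite dec-false (i ℕ.≟ k) i≢k = refl

≔-cong : ∀ {A : Set} {ω ω′ : ℕ → A} k b {i} → (i ≢ k → ω i ≡ ω′ i) →
  (ω [ k ≔ b ]) i ≡ (ω′ [ k ≔ b ]) i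
≔-cong k b {i} eq with i ℕ.≟ k
... | yes i≡k rewrite dec-true  (i ℕ.≟ k) i≡k = refl
... | no  i≢k rewrite dec-false (i ℕ.≟ k) i≢k = eq i≢k

_≐_except_ : Coins → Coins → ℕ → Set
ω ≐ ω′ except e = ∀ i → i ≢ e → ω i ≡ ω′ i

Ignores : ℕ → (Coins → ℚ) → Set
Ignores e h = ∀ {ω ω′} → ω ≐ ω′ except e → h ω ≡ h ω′

module Tossing (p : ℕ → ℚ) (random : ℕ → Bool) where

  -- Coin i shows true with probability p i; from coin k on, all coins show true.
  𝔼 : ℕ → (Coins → ℚ) → ℚ
  𝔼 zero    f = f (λ _ → true)
  𝔼 (suc k) f = p k ℚ.* 𝔼 k (λ ω → f (ω [ k ≔ true ]))
          ℚ.+ (1ℚ ℚ.- p k) ℚ.* 𝔼 k (λ ω → f (ω [ k ≔ false ]))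

  𝔼-cong : ∀ k {f g} → (∀ ω → f ω ≡ g ω) → 𝔼 k f ≡ 𝔼 k g
  𝔼-cong zero    f≡g = f≡g _
  𝔼-cong (suc k) f≡g = cong₂ ℚ._+_
    (cong (p k ℚ.*_) (𝔼-cong k λ _ → f≡g _))
    (cong ((1ℚ ℚ.- p k) ℚ.*_) (𝔼-cong k λ _ → f≡g _))

  -- If `e` is the topmost coin, both sides toss it, and `h₁` and `h₂` do not notice how it falls.
  -- Otherwise fixing the topmost coin leaves an instance with one coin fewer, and the identity
  -- given to the solver exchanges the two tosses.
  𝔼-coin : ∀ {k e h₁ h₂} → e < k → Ignores e h₁ → Ignores e h₂ →
    𝔼 k (λ ω → if ω e then h₁ ω else h₂ ω) ≡ p e ℚ.* 𝔼 k h₁ ℚ.+ (1ℚ ℚ.- p e) ℚ.* 𝔼 k h₂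
  𝔼-coin {suc k} {e} {h₁} {h₂} e<1+k ig₁ ig₂ with e ℕ.≟ k
  ... | yes refl = cong₂ ℚ._+_
        (cong (p e ℚ.*_) (trans
          (𝔼-cong e λ ω → cong (if_then h₁ (ω [ e ≔ true ]) else h₂ (ω [ e ≔ true ])) (≔-same ω e true))
          (constant true h₁ ig₁)))
        (cong ((1ℚ ℚ.- p e) ℚ.*_) (trans
          (𝔼-cong e λ ω → cong (if_then h₁ (ω [ e ≔ false ]) else h₂ (ω [ e ≔ false ])) (≔-same ω e false))
          (constant false h₂ ig₂)))
    where
    constant : ∀ b h → Ignores e h → 𝔼 e (λ ω → h (ω [ e ≔ b ])) ≡ 𝔼 (suc e) h
    constant b h ig = trans
      (sym (average (p e) (𝔼 e (λ ω → h (ω [ e ≔ b ])))))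
      (cong₂ ℚ._+_ (cong (p e ℚ.*_) (flip-coin true)) (cong ((1ℚ ℚ.- p e) ℚ.*_) (flip-coin false)))
      where
      flip-coin : ∀ b′ → 𝔼 e (λ ω → h (ω [ e ≔ b ])) ≡ 𝔼 e (λ ω → h (ω [ e ≔ b′ ]))
      flip-coin b′ = 𝔼-cong e λ ω → ig λ i i≢e → trans (≔-other ω b i≢e) (sym (≔-other ω b′ i≢e))
  ... | no e≢k = trans
        (cong₂ ℚ._+_ (cong (p k ℚ.*_) (below true)) (cong ((1ℚ ℚ.- p k) ℚ.*_) (below false)))
        (solve 6 (λ q s a b c d →
            q :* (s :* a :+ (con 1ℚ :- s) :* b) :+ (con 1ℚ :- q) :* (s :* c :+ (con 1ℚ :- s) :* d)
            := s :* (q :* a :+ (con 1ℚ :- q) :* c) :+ (con 1ℚ :- s) :* (q :* b :+ (con 1ℚ :- q) :* d))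
          refl (p k) (p e) _ _ _ _)
    where
    shift : ∀ b h → Ignores e h → Ignores e (λ ω → h (ω [ k ≔ b ]))
    shift b h ig {ω} {ω′} eq = ig λ i i≢e → ≔-cong {ω = ω} {ω′} k b (λ _ → eq i i≢e)

    below : ∀ b →
      𝔼 k (λ ω → if (ω [ k ≔ b ]) e then h₁ (ω [ k ≔ b ]) else h₂ (ω [ k ≔ b ])) ≡
      p e ℚ.* 𝔼 k (λ ω → h₁ (ω [ k ≔ b ])) ℚ.+ (1ℚ ℚ.- p e) ℚ.* 𝔼 k (λ ω → h₂ (ω [ k ≔ b ]))
    below b = trans
      (𝔼-cong k λ ω → cong (if_then h₁ (ω [ k ≔ b ]) else h₂ (ω [ k ≔ b ])) (≔-other ω b e≢k))
      (𝔼-coin (ℕ.≤∧≢⇒< (ℕ.≤-pred e<1+k) e≢k) (shift b h₁ ig₁) (shift b h₂ ig₂))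

  -- A doubling recursion rather than a power of two: it can be carried out coin by coin to fill
  -- `table`, and decoding uses all its intermediate values.
  outcomes : ℕ → ℕ
  outcomes zero    = 1
  outcomes (suc k) = if random k then outcomes k + outcomes k else outcomes k

  -- Reading j in binary, with one digit per random coin, enumerates the outcomes
  -- of the first k coins.
  coins : ℕ → ℕ → Coins
  coins zero    j = λ _ → true
  coins (suc k) j =
    if random k
    then (if does (j ℕ.<? outcomes k) then coins k j [ k ≔ false ]
                                      else coins k (j ∸ outcomes k) [ k ≔ true ])
    else coins k j [ k ≔ true ]

  chance : ℕ → ℕ → ℚ
  chance zero    j = 1ℚ
  chance (suc k) j =
    if random k
    then (if does (j ℕ.<? outcomes k) then (1ℚ ℚ.- p k) ℚ.* chance k j
                                      else p k ℚ.* chance k (j ∸ outcomes k))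
    else chance k j

  -- A certain coin has probability 1, so its false branch contributes nothing. A random coin
  -- doubles the range: with `N` outcomes of the earlier coins, the number `j` below `N` sets it to
  -- false, `N + j` sets it to true, and `j` encodes the rest.
  𝔼-enumerate : ∀ k f → (∀ i → i < k → random i ≡ false → p i ≡ 1ℚ) →
    𝔼 k f ≡ sum (outcomes k) (λ j → chance k j ℚ.* f (coins k j))
  𝔼-enumerate zero    f certain = sym (trans (ℚ.+-identityʳ _) (ℚ.*-identityˡ _))
  𝔼-enumerate (suc k) f certain with random k in eq
  ... | false = begin
    p k ℚ.* t ℚ.+ (1ℚ ℚ.- p k) ℚ.* e  ≡⟨ cong (λ q → q ℚ.* t ℚ.+ (1ℚ ℚ.- q) ℚ.* e) (certain k ℕ.≤-refl eq) ⟩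
    1ℚ ℚ.* t ℚ.+ (1ℚ ℚ.- 1ℚ) ℚ.* e    ≡⟨ solve 2 (λ t e → con 1ℚ :* t :+ (con 1ℚ :- con 1ℚ) :* e := t) refl t e ⟩
    t                                 ≡⟨ 𝔼-enumerate k _ (λ i i<k → certain i (ℕ.m<n⇒m<1+n i<k)) ⟩
    _                                 ∎
    where
    open ≡-Reasoning
    t = 𝔼 k (λ ω → f (ω [ k ≔ true ]))
    e = 𝔼 k (λ ω → f (ω [ k ≔ false ]))
  ... | true = sym (trans (sum-split N N F) (cong₂ ℚ._+_
          (half (p k) true (λ j → F (N + j)) above)
          (half (1ℚ ℚ.- p k) false F below)))
    where
    N = outcomes k
    F : ℕ → ℚ
    F j = (if does (j ℕ.<? N) then (1ℚ ℚ.- p k) ℚ.* chance k j else p k ℚ.* chance k (j ∸ N))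
      ℚ.* f (if does (j ℕ.<? N) then coins k j [ k ≔ false ] else coins k (j ∸ N) [ k ≔ true ])

    above : ∀ j → j < N → F (N + j) ≡ p k ℚ.* chance k j ℚ.* f (coins k j [ k ≔ true ])
    above j _ rewrite dec-false (N + j ℕ.<? N) (ℕ.≤⇒≯ (ℕ.m≤m+n N j)) | ℕ.m+n∸m≡n N j = refl

    below : ∀ j → j < N → F j ≡ (1ℚ ℚ.- p k) ℚ.* chance k j ℚ.* f (coins k j [ k ≔ false ])
    below j j<N rewrite dec-true (j ℕ.<? N) j<N = refl

    half : ∀ q b G → (∀ j → j < N → G j ≡ q ℚ.* chance k j ℚ.* f (coins k j [ k ≔ b ])) →
      sum N G ≡ q ℚ.* 𝔼 k (λ ω → f (ω [ k ≔ b ]))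
    half q b G G≡ = begin
      sum N G                                                         ≡⟨ sum-cong N (λ j j<N → trans (G≡ j j<N) (ℚ.*-assoc q _ _)) ⟩
      sum N (λ j → q ℚ.* (chance k j ℚ.* f (coins k j [ k ≔ b ])))    ≡⟨ sum-*ˡ N q _ ⟩
      q ℚ.* sum N (λ j → chance k j ℚ.* f (coins k j [ k ≔ b ]))      ≡⟨ cong (q ℚ.*_) (𝔼-enumerate k _ (λ i i<k → certain i (ℕ.m<n⇒m<1+n i<k))) ⟨
      q ℚ.* 𝔼 k (λ ω → f (ω [ k ≔ b ]))                               ∎
      where open ≡-Reasoning

  outcomes-random : ∀ k → random k ≡ true → outcomes (suc k) ≡ outcomes k + outcomes k
  outcomes-random k eq rewrite eq = refl

  outcomes-certain : ∀ k → random k ≡ false → outcomes (suc k) ≡ outcomes k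
  outcomes-certain k eq rewrite eq = refl

  -- Coin k shows b, which contributes the factor q, and y encodes coins 0, …, k - 1.
  Leading : ℕ → ℕ → Bool → ℚ → ℕ → Set
  Leading k j b q y =
    y < outcomes k × chance (suc k) j ≡ q ℚ.* chance k y × coins (suc k) j ≡ coins k y [ k ≔ b ]

  leading-certain : ∀ k {j} → j < outcomes (suc k) → random k ≡ false → Leading k j true 1ℚ j
  leading-certain k j< eq rewrite eq = j< , sym (ℚ.*-identityˡ _) , refl

  leading-false : ∀ k {j} → random k ≡ true → j < outcomes k → Leading k j false (1ℚ ℚ.- p k) j
  leading-false k {j} eq j< rewrite eq | dec-true (j ℕ.<? outcomes k) j< = j< , refl , refl

  leading-true : ∀ k {j} → j < outcomes (suc k) → random k ≡ true → ¬ j < outcomes k →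
    Leading k j true (p k) (j ∸ outcomes k)
  leading-true k {j} j< eq j≮ rewrite eq | dec-false (j ℕ.<? outcomes k) j≮ =
    subst (j ∸ outcomes k <_) (ℕ.m+n∸n≡m (outcomes k) (outcomes k)) (ℕ.∸-monoˡ-< j< (ℕ.≮⇒≥ j≮)) ,
    refl , refl

-- The cascade with coins tossed in advance

-- Conditioning on the first time step replaces an event by its conditional probability, a rational
-- function of the cascade; `Pr` measures events only.
expect : ∀ {A} → Random A → (A → ℚ) → ℚ
expect (return a) f = f a
expect (flip p k) f = p ℚ.* expect (k true) f ℚ.+ (1ℚ ℚ.- p) ℚ.* expect (k false) f

expect-cong : ∀ {A} (x : Random A) {f g} → (∀ a → f a ≡ g a) → expect x f ≡ expect x g
expect-cong (return a) f≡g = f≡g a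
expect-cong (flip p k) f≡g = cong₂ ℚ._+_
  (cong (p ℚ.*_) (expect-cong (k true) f≡g))
  (cong ((1ℚ ℚ.- p) ℚ.*_) (expect-cong (k false) f≡g))

expect->>= : ∀ {A B} (x : Random A) {f : A → Random B} {g} →
  expect (x >>= f) g ≡ expect x (λ a → expect (f a) g)
expect->>= (return a) = refl
expect->>= (flip p k) = cong₂ ℚ._+_
  (cong (p ℚ.*_) (expect->>= (k true)))
  (cong ((1ℚ ℚ.- p) ℚ.*_) (expect->>= (k false)))

Pr-expect : ∀ {A} P (x : Random A) → Pr P x ≡ expect x (ind ∘ P)
Pr-expect P (return a) = refl
Pr-expect P (flip p k) = cong₂ ℚ._+_
  (cong (p ℚ.*_) (Pr-expect P (k true)))
  (cong ((1ℚ ℚ.- p) ℚ.*_) (Pr-expect P (k false)))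

-- Counting the random coins

countBelow : (ℕ → Bool) → ℕ → ℕ
countBelow b zero    = 0
countBelow b (suc k) = if b k then suc (countBelow b k) else countBelow b k

-- `countBelow` peels off the last coin, as `outcomes` does, whereas filtering `allFin` peels off
-- the first arc; this reconciles the two.
countBelow-first : ∀ b k → countBelow b (suc k) ≡ bit (b 0) + countBelow (b ∘ suc) k
countBelow-first b zero with b 0
... | true  = refl
... | false = refl
countBelow-first b (suc k) with b (suc k)
... | true  = trans (cong suc (countBelow-first b k)) (sym (ℕ.+-suc (bit (b 0)) _))
... | false = countBelow-first b k

length-filter-tabulate : ∀ {A : Set} {P : A → Set} (P? : ∀ a → Dec (P a)) {k} (f : Fin k → A) b →
  (∀ i → b (toℕ i) ≡ does (P? (f i))) → length (filter P? (tabulate f)) ≡ countBelow b k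
length-filter-tabulate P? {zero}  f b b≡ = refl
length-filter-tabulate P? {suc k} f b b≡ = trans count (sym (countBelow-first b k))
  where
  rest = length-filter-tabulate P? (f ∘ Fin.suc) (b ∘ suc) (b≡ ∘ Fin.suc)
  count : length (filter P? (tabulate f)) ≡ bit (b 0) + countBelow (b ∘ suc) k
  count with P? (f Fin.zero) | b≡ Fin.zero
  ... | yes _ | eq rewrite eq = cong suc rest
  ... | no  _ | eq rewrite eq = rest

module LiveEdges {n : ℕ} (G : InfluenceGraph n) where
  open InfluenceGraph G

  coin : ℕ → ℚ
  coin = tabulated 0ℚ w

  random : ℕ → Bool
  random k = does (coin k ℚ.<? 1ℚ)

  open Tossing coin random public

  attempted : Cascade n → Fin m → Bool
  attempted s e = does (src e ∈? fresh s) ∧ not (does (tgt e ∈? active s))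

  hits : Coins → List (Fin m) → Cascade n → Subset n
  hits ω []       s = ∅
  hits ω (e ∷ es) s =
    if attempted s e
    then (if ω (toℕ e) then ⁅ tgt e ⁆ ∪ hits ω es s else hits ω es s)
    else hits ω es s

  next : Cascade n → Subset n → Cascade n
  next s hit = cascade (active s ∪ hit) hit

  runWith : Coins → ℕ → Cascade n → Cascade n
  runWith ω zero    s = s
  runWith ω (suc t) s = runWith ω t (next s (hits ω (allFin m) s))

  hits⁻ : ∀ ω es s {v} → v ∈ hits ω es s →
    ∃[ e ] (src e ∈ fresh s × tgt e ∉ active s × ω (toℕ e) ≡ true × tgt e ≡ v)
  hits⁻ ω []       s v∈ = ⊥-elim (∉⊥ v∈)
  hits⁻ ω (e ∷ es) s v∈ with src e ∈? fresh s | tgt e ∈? active s | ω (toℕ e) in live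
  ... | no  _    | _        | _     = hits⁻ ω es s v∈
  ... | yes _    | yes _    | _     = hits⁻ ω es s v∈
  ... | yes _    | no  _    | false = hits⁻ ω es s v∈
  ... | yes src∈ | no  tgt∉ | true with x∈p∪q⁻ ⁅ tgt e ⁆ _ v∈
  ...   | inj₁ v∈⁅⁆  = e , src∈ , tgt∉ , live , sym (x∈⁅y⁆⇒x≡y _ v∈⁅⁆)
  ...   | inj₂ v∈hit = hits⁻ ω es s v∈hit

  hits⁺ : ∀ ω es s {e} → e ∈ˡ es → src e ∈ fresh s → tgt e ∉ active s → ω (toℕ e) ≡ true →
    tgt e ∈ hits ω es s
  hits⁺ ω (e ∷ es) s (here refl) src∈ tgt∉ live
    rewrite dec-true (src e ∈? fresh s) src∈ | dec-false (tgt e ∈? active s) tgt∉ | live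
    = x∈p∪q⁺ (inj₁ (x∈⁅x⁆ _))
  hits⁺ ω (e ∷ es) s (there e∈) src∈ tgt∉ live with attempted s e | ω (toℕ e)
  ... | false | _     = hits⁺ ω es s e∈ src∈ tgt∉ live
  ... | true  | false = hits⁺ ω es s e∈ src∈ tgt∉ live
  ... | true  | true  = x∈p∪q⁺ (inj₂ (hits⁺ ω es s e∈ src∈ tgt∉ live))

  hits-cong : ∀ {ω ω′} es s → (∀ e → e ∈ˡ es → src e ∈ fresh s → ω (toℕ e) ≡ ω′ (toℕ e)) →
    hits ω es s ≡ hits ω′ es s
  hits-cong []       s eq = refl
  hits-cong (e ∷ es) s eq
    with hits-cong es s (λ e′ → eq e′ ∘ there) | src e ∈? fresh s | tgt e ∈? active s
  ... | ih | no  _    | _     = ih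
  ... | ih | yes _    | yes _ = ih
  ... | ih | yes src∈ | no  _ rewrite eq e (here refl) src∈ | ih = refl

  Disjoint : Cascade n → Subset n → Set
  Disjoint s hit = ∀ {v} → v ∈ hit → v ∉ active s

  hits-disjoint : ∀ ω es s → Disjoint s (hits ω es s)
  hits-disjoint ω es s v∈ with hits⁻ ω es s v∈
  ... | _ , _ , tgt∉ , _ , refl = tgt∉

  -- An arc whose source is active but no longer fresh has had its attempt.
  runWith-cong : ∀ t s {ω ω′} →
    (∀ e → (src e ∈ active s → src e ∈ fresh s) → ω (toℕ e) ≡ ω′ (toℕ e)) →
    runWith ω t s ≡ runWith ω′ t s
  runWith-cong zero    s eq = refl
  runWith-cong (suc t) s {ω} {ω′} eq
    rewrite hits-cong {ω} {ω′} (allFin m) s (λ e _ src∈ → eq e (λ _ → src∈))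
    -- If the source were active already, `fresh′` would put it among the new hits, which are
    -- disjoint from the active nodes. So the premise of `eq` holds vacuously.
    = runWith-cong t _ λ e fresh′ → eq e λ src∈ →
        contradiction src∈ (hits-disjoint ω′ (allFin m) s (fresh′ (x∈p∪q⁺ (inj₁ src∈))))

  -- `g` stands for the rest of the process. By `Unique` no other attempt in the list uses the coin
  -- of `e`, and by hypothesis neither does `g`, so `𝔼-coin` applies. The hypothesis is confined to
  -- hits that avoid active nodes: only these occur, and if a hit contained the source of `e`, the
  -- process could attempt `e` again.
  attempts-𝔼 : ∀ {s} es (g : Subset n → Coins → ℚ) → Unique es →
    (∀ hit e → Disjoint s hit → src e ∈ fresh s → Ignores (toℕ e) (g hit)) →
    expect (attempts G es s) (λ hit → 𝔼 m (g hit)) ≡ 𝔼 m (λ ω → g (hits ω es s) ω)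
  attempts-𝔼 []       g _              ig = refl
  attempts-𝔼 {s} (e ∷ es) g (e∉es ∷ unique) ig with src e ∈? fresh s | tgt e ∈? active s
  ... | no  _    | _        = attempts-𝔼 es g unique ig
  ... | yes _    | yes _    = attempts-𝔼 es g unique ig
  ... | yes src∈ | no  tgt∉ = begin
    w e ℚ.* expect (attempts G es s >>= λ hit → return (⁅ tgt e ⁆ ∪ hit)) E ℚ.+
      (1ℚ ℚ.- w e) ℚ.* expect (attempts G es s >>= λ hit → return hit) E
      ≡⟨ cong₂ (λ a b → w e ℚ.* a ℚ.+ (1ℚ ℚ.- w e) ℚ.* b)
           (trans (expect->>= (attempts G es s)) (attempts-𝔼 es (g ∘ (⁅ tgt e ⁆ ∪_)) unique
             (λ hit e′ disjoint → ig _ e′ (add disjoint))))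
           (trans (expect->>= (attempts G es s)) (attempts-𝔼 es g unique ig)) ⟩
    w e ℚ.* 𝔼 m success ℚ.+ (1ℚ ℚ.- w e) ℚ.* 𝔼 m failure
      ≡⟨ cong (λ q → q ℚ.* 𝔼 m success ℚ.+ (1ℚ ℚ.- q) ℚ.* 𝔼 m failure) (sym (tabulated-toℕ 0ℚ w e)) ⟩
    coin (toℕ e) ℚ.* 𝔼 m success ℚ.+ (1ℚ ℚ.- coin (toℕ e)) ℚ.* 𝔼 m failure
      ≡⟨ 𝔼-coin (Fin.toℕ<n e)
           (λ {ω} {ω′} eq → trans (cong (λ hit → g (⁅ tgt e ⁆ ∪ hit) ω) (same eq))
             (ig _ e (add (hits-disjoint ω′ es s)) src∈ eq))
           (λ {ω} {ω′} eq → trans (cong (λ hit → g hit ω) (same eq))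
             (ig _ e (hits-disjoint ω′ es s) src∈ eq)) ⟨
    𝔼 m (λ ω → if ω (toℕ e) then success ω else failure ω)
      ≡⟨ 𝔼-cong m (λ ω → merge ω (ω (toℕ e))) ⟩
    𝔼 m (λ ω → g (if ω (toℕ e) then ⁅ tgt e ⁆ ∪ hits ω es s else hits ω es s) ω) ∎
    where
    open ≡-Reasoning
    E = λ hit → 𝔼 m (g hit)
    success failure : Coins → ℚ
    success ω = g (⁅ tgt e ⁆ ∪ hits ω es s) ω
    failure ω = g (hits ω es s) ω

    add : ∀ {hit} → Disjoint s hit → Disjoint s (⁅ tgt e ⁆ ∪ hit)
    add {hit} disjoint v∈ with x∈p∪q⁻ ⁅ tgt e ⁆ hit v∈
    ... | inj₁ v∈⁅⁆  = subst (_∉ active s) (sym (x∈⁅y⁆⇒x≡y _ v∈⁅⁆)) tgt∉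
    ... | inj₂ v∈hit = disjoint v∈hit

    same : ∀ {ω ω′} → ω ≐ ω′ except toℕ e → hits ω es s ≡ hits ω′ es s
    same eq = hits-cong es s λ e′ e′∈ _ → eq (toℕ e′) λ e′≡e →
      All.lookup e∉es e′∈ (sym (Fin.toℕ-injective e′≡e))

    merge : ∀ ω b → (if b then success ω else failure ω) ≡
      g (if b then ⁅ tgt e ⁆ ∪ hits ω es s else hits ω es s) ω
    merge ω true  = refl
    merge ω false = refl

  -- The source of an attempted arc is fresh, hence active, so it is not among the hits of this time
  -- step: afterwards it is active but no longer fresh. By `runWith-cong` the rest of the run then
  -- ignores the coin of the arc, as `attempts-𝔼` demands.
  run-𝔼 : ∀ P t s → (∀ {v} → v ∈ fresh s → v ∈ active s) →
    Pr P (run G t s) ≡ 𝔼 m (λ ω → ind (P (runWith ω t s)))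
  run-𝔼 P zero    s fresh⊆active = sym (𝔼-const m)
    where
    𝔼-const : ∀ k {c} → 𝔼 k (λ _ → c) ≡ c
    𝔼-const zero        = refl
    𝔼-const (suc k) {c} rewrite 𝔼-const k {c} = average (coin k) c
  run-𝔼 P (suc t) s fresh⊆active = begin
    Pr P (step G s >>= run G t)
      ≡⟨ Pr-expect P (step G s >>= run G t) ⟩
    expect (step G s >>= run G t) (ind ∘ P)
      ≡⟨ expect->>= (step G s) ⟩
    expect (step G s) (λ s′ → expect (run G t s′) (ind ∘ P))
      ≡⟨ expect->>= (attempts G (allFin m) s) ⟩
    expect (attempts G (allFin m) s) (λ hit → expect (run G t (next s hit)) (ind ∘ P))
      ≡⟨ expect-cong (attempts G (allFin m) s) (λ hit →
           trans (sym (Pr-expect P (run G t (next s hit))))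
                 (run-𝔼 P t (next s hit) λ v∈ → x∈p∪q⁺ (inj₂ v∈))) ⟩
    expect (attempts G (allFin m) s) (λ hit → 𝔼 m (λ ω → ind (P (runWith ω t (next s hit)))))
      ≡⟨ attempts-𝔼 (allFin m) _ (allFin⁺ m) (λ hit e disjoint src∈ eq →
           cong (ind ∘ P) (runWith-cong t (next s hit) λ e′ fresh′ →
             eq (toℕ e′) λ e′≡e → disjoint (fresh′ (x∈p∪q⁺ (inj₁ (source∈ src∈ e′≡e)))) (source∈ src∈ e′≡e))) ⟩
    𝔼 m (λ ω → ind (P (runWith ω (suc t) s))) ∎
    where
    open ≡-Reasoning
    source∈ : ∀ {e e′} → src e ∈ fresh s → toℕ e′ ≡ toℕ e → src e′ ∈ active s
    source∈ src∈ e′≡e rewrite Fin.toℕ-injective e′≡e = fresh⊆active src∈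

  -- Reachability along live arcs

  -- `stay` lets the clock run on, so this is reachability by at most `t` live arcs: the active set
  -- at time `t`, and the set marked by the machine after `t` rounds.
  data Reach (ω : Coins) (X : Subset n) : ℕ → Fin n → Set where
    source : ∀ {v} → v ∈ X → Reach ω X 0 v
    stay   : ∀ {t v} → Reach ω X t v → Reach ω X (suc t) v
    arc    : ∀ {t} e → ω (toℕ e) ≡ true → Reach ω X t (src e) → Reach ω X (suc t) (tgt e)

  -- `runWith` unfolds at the first time step, but `Reach` grows at the last one.
  runWith-suc : ∀ ω t s → runWith ω (suc t) s ≡
    next (runWith ω t s) (hits ω (allFin m) (runWith ω t s))
  runWith-suc ω zero    s = refl
  runWith-suc ω (suc t) s = runWith-suc ω t _

  module _ (ω : Coins) (X : Subset n) where

    state : ℕ → Cascade n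
    state t = runWith ω t (start G X)

    reach-⇐ : ∀ t {v} → v ∈ active (state t) → Reach ω X t v
    fresh⊆active : ∀ t {v} → v ∈ fresh (state t) → v ∈ active (state t)

    fresh⊆active zero    v∈ = v∈
    fresh⊆active (suc t) v∈ rewrite runWith-suc ω t (start G X) = x∈p∪q⁺ (inj₂ v∈)

    reach-⇐ zero    v∈ = source v∈
    reach-⇐ (suc t) v∈ rewrite runWith-suc ω t (start G X)
      with x∈p∪q⁻ (active (state t)) _ v∈
    ... | inj₁ v∈active = stay (reach-⇐ t v∈active)
    ... | inj₂ v∈hits with hits⁻ ω (allFin m) (state t) v∈hits
    ...   | e , src∈ , _ , live , refl = arc e live (reach-⇐ t (fresh⊆active t src∈))

    -- Both statements are proved together by induction on time. A fresh source attempts the arc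
    -- now, unless the target is active already. An active source that is not fresh was active one
    -- time step earlier, and by then the arc had brought in its target. At time 0 every active node
    -- is fresh.
    extend : ∀ t {e} → ω (toℕ e) ≡ true → src e ∈ active (state t) → tgt e ∈ active (state (suc t))
    used   : ∀ t {e} → ω (toℕ e) ≡ true → src e ∈ active (state t) → src e ∉ fresh (state t) →
      tgt e ∈ active (state t)

    extend t {e} live src∈ rewrite runWith-suc ω t (start G X)
      with tgt e ∈? active (state t) | src e ∈? fresh (state t)
    ... | yes tgt∈ | _          = x∈p∪q⁺ (inj₁ tgt∈)
    ... | no  _    | no src∉    = x∈p∪q⁺ (inj₁ (used t live src∈ src∉))
    ... | no  tgt∉ | yes fresh∈ = x∈p∪q⁺ (inj₂ (hits⁺ ω (allFin m) (state t) (∈-allFin e) fresh∈ tgt∉ live))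

    used zero    live src∈ src∉ = contradiction src∈ src∉
    used (suc t) {e} live src∈ src∉ = extend t live src∈′
      where
      src∈′ : src e ∈ active (state t)
      src∈′ rewrite runWith-suc ω t (start G X) with x∈p∪q⁻ (active (state t)) _ src∈
      ... | inj₁ src∈active = src∈active
      ... | inj₂ src∈hits   = contradiction src∈hits src∉

    reach-⇒ : ∀ t {v} → Reach ω X t v → v ∈ active (state t)
    reach-⇒ zero    (source v∈)   = v∈
    reach-⇒ (suc t) (stay r)      rewrite runWith-suc ω t (start G X) = x∈p∪q⁺ (inj₁ (reach-⇒ t r))
    reach-⇒ (suc t) (arc e live r) = extend t live (reach-⇒ t r)

  outcomes-2^ : ∀ k → outcomes k ≡ 2 ^ countBelow random k
  outcomes-2^ zero = refl
  outcomes-2^ (suc k) with random k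
  ... | true  rewrite outcomes-2^ k = sym (cong (2 ^ countBelow random k +_) (ℕ.+-identityʳ _))
  ... | false = outcomes-2^ k

  outcomes-m : outcomes m ≡ 2 ^ r
  outcomes-m = trans (outcomes-2^ m) (cong (2 ^_) (sym (length-filter-tabulate (λ e → w e ℚ.<? 1ℚ) id random
    (λ i → cong (λ q → does (q ℚ.<? 1ℚ)) (tabulated-toℕ 0ℚ w i)))))

  probability : ∀ X v → p G X v ≡
    sum (2 ^ r) (λ j → chance m j ℚ.* ind (does (v ∈? active (state (coins m j) X n))))
  probability X v = trans
    (run-𝔼 _ n (start G X) id)
    (trans (𝔼-enumerate m _ certain)
      (cong (λ N → sum N (λ j → chance m j ℚ.* ind (does (v ∈? active (state (coins m j) X n))))) outcomes-m))
    where
    certain : ∀ i → i < m → random i ≡ false → coin i ≡ 1ℚ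
    certain i i<m eq with coin i ℚ.<? 1ℚ
    ... | yes c<1 = contradiction (trans (sym (dec-true (coin i ℚ.<? 1ℚ) c<1)) eq) λ ()
    ... | no  c≮1 = ℚ.≤-antisym (subst (ℚ._≤ 1ℚ) (trans (sym (tabulated-toℕ 0ℚ w (fromℕ< i<m)))
                     (cong coin (Fin.toℕ-fromℕ< i<m))) (w≤1 _)) (ℚ.≮⇒≥ c≮1)

-- A program logic with running times

-- Total correctness: the halting execution is part of the data. Only its running time is relaxed to
-- an upper bound, so that a conditional can be charged with its dearer branch.
record Runs (P : Program) (σ : Store) (T : ℕ) (Q : Store → Set) : Set where
  constructor runs
  field
    {final}   : Store
    {time}    : ℕ
    execution : ⟨ P , σ ⟩⇓⟨ final , time ⟩
    time≤     : time ≤ T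
    post      : Q final

infixr 3 _⨟_

run-skip : ∀ {σ Q} → Q σ → Runs skip σ 1 Q
run-skip q = runs skip ℕ.≤-refl q

run-set : ∀ {a i x σ Q} → Q (store (update a (⟦ i ⟧ σ) (⟦ x ⟧ σ) (nat σ)) (rat σ)) →
  Runs (set a i x) σ (suc (cost i + cost x)) Q
run-set q = runs set ℕ.≤-refl q

run-setᵣ : ∀ {a i x σ Q} → Q (store (nat σ) (update a (⟦ i ⟧ σ) (⟦ x ⟧ᵣ σ) (rat σ))) →
  Runs (setᵣ a i x) σ (suc (cost i + costᵣ x)) Q
run-setᵣ q = runs setᵣ ℕ.≤-refl q

-- The triple for the second program is the postcondition of the first. After an assignment the
-- store in between is thus found by computation; `_⨟_` serves where only an assertion about it is
-- known, as after a loop.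
run-⨾ : ∀ {P P′ σ T U Q} → Runs P σ T (λ σ′ → Runs P′ σ′ U Q) → Runs (P ⨾ P′) σ (T + U) Q
run-⨾ (runs e t≤ (runs e′ t′≤ q)) = runs (e ⨾ e′) (ℕ.+-mono-≤ t≤ t′≤) q

mono : ∀ {P σ T Q Q′} → Runs P σ T Q → (∀ {σ′} → Q σ′ → Q′ σ′) → Runs P σ T Q′
mono (runs e t≤ q) f = runs e t≤ (f q)

_⨟_ : ∀ {P P′ σ T U Q R} → Runs P σ T R → (∀ {σ′} → R σ′ → Runs P′ σ′ U Q) →
  Runs (P ⨾ P′) σ (T + U) Q
r ⨟ f = run-⨾ (mono r f)

run-if : ∀ {b P P′ σ T U Q} → (⟦ b ⟧ₜ σ ≡ true → Runs P σ T Q) → (⟦ b ⟧ₜ σ ≡ false → Runs P′ σ U Q) →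
  Runs (ifᵖ b then P else P′) σ (suc (costₜ b + (T ⊔ U))) Q
run-if {b} {σ = σ} {T} {U} f g with ⟦ b ⟧ₜ σ in eq
... | true  with f refl
...   | runs e t≤ q = runs (if-true eq e) (s≤s (ℕ.+-monoʳ-≤ (costₜ b) (ℕ.≤-trans t≤ (ℕ.m≤m⊔n T U)))) q
run-if {b} {σ = σ} {T} {U} f g | false with g refl
...   | runs e t≤ q = runs (if-false eq e) (s≤s (ℕ.+-monoʳ-≤ (costₜ b) (ℕ.≤-trans t≤ (ℕ.m≤n⊔m T U)))) q

-- The index of `Inv` is the exact number of iterations to come, which also yields termination. The
-- last summand pays for the failing test.
run-while : ∀ {b P T} (Inv : ℕ → Store → Set) →
  (∀ {k σ} → Inv (suc k) σ → ⟦ b ⟧ₜ σ ≡ true × Runs P σ T (Inv k)) →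
  (∀ {σ} → Inv 0 σ → ⟦ b ⟧ₜ σ ≡ false) →
  ∀ {k σ} → Inv k σ → Runs (while b run P) σ (k * suc (costₜ b + T) + suc (costₜ b)) (Inv 0)
run-while Inv body exit {zero}  inv = runs (while-false (exit inv)) ℕ.≤-refl inv
run-while {b} {T = T} Inv body exit {suc k} inv with body inv
... | continue , runs e t≤ inv′ with run-while Inv body exit inv′
...   | runs e′ t′≤ q = runs (while-true continue e e′)
        (ℕ.≤-trans (s≤s (ℕ.+-mono-≤ (ℕ.+-monoʳ-≤ (costₜ b) t≤) t′≤))
          (ℕ.≤-reflexive (sym (ℕ.+-assoc (suc (costₜ b + T)) (k * suc (costₜ b + T)) _))))
        q

var : ℕ → Exp
var a = get a (lit 0)

decrement : ℕ → Store → Store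
decrement a σ = store (update a 0 (nat σ a 0 ∸ 1) (nat σ)) (rat σ)

countdown : ℕ → Program → Program
countdown c P = while lit 0 ≺ var c run (set c (lit 0) (var c ⊖ lit 1) ⨾ P)

Iteration : ℕ → Program → ℕ → (ℕ → Store → Set) → Set
Iteration c P T Inv = ∀ {k σ} → Inv (suc k) σ → nat (decrement c σ) c 0 ≡ k →
  Runs P (decrement c σ) T (λ σ′ → nat σ′ c 0 ≡ k × Inv k σ′)

-- The loop test costs 5 and the decrement 6, hence 11 per iteration and 5 at the end. The decrement
-- precedes the body, so the body sees the indices from `k - 1` down to 0 and has to give the
-- counter back unchanged.
run-countdown : ∀ {P T} c (Inv : ℕ → Store → Set) → Iteration c P T Inv →
  ∀ {k σ} → nat σ c 0 ≡ k → Inv k σ → Runs (countdown c P) σ (k * (11 + T) + 5) (Inv 0)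
run-countdown c Inv body ctr j = mono
  (run-while (λ k σ → nat σ c 0 ≡ k × Inv k σ)
    (λ {_} {σ} (ctr , j) → cong (λ x → does (0 ℕ.<? x)) ctr , run-⨾ (run-set (body j (decremented {σ = σ} ctr))))
    (λ (ctr , _) → cong (λ x → does (0 ℕ.<? x)) ctr)
    (ctr , j))
  proj₂
  where
  decremented : ∀ {k σ} → nat σ c 0 ≡ suc k → nat (decrement c σ) c 0 ≡ k
  decremented ctr rewrite dec-true (c ℕ.≟ c) refl = cong (_∸ 1) ctr

-- Running time of loop-free programs; the value for loops is junk.
worst : Program → ℕ
worst skip                    = 1
worst (set a i x)             = suc (cost i + cost x)
worst (setᵣ a i x)            = suc (cost i + costᵣ x)
worst (P ⨾ Q)                 = worst P + worst Q
worst (ifᵖ b then P else Q)   = suc (costₜ b + (worst P ⊔ worst Q))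
worst (while b run P)         = 0

does-true : ∀ {P : Set} (P? : Dec P) → does P? ≡ true → P
does-true (yes p) _ = p

does-false : ∀ {P : Set} (P? : Dec P) → does P? ≡ false → ¬ P
does-false (no ¬p) _ = ¬p

positive-bit : ∀ b → does (0 ℕ.<? bit b) ≡ b
positive-bit true  = refl
positive-bit false = refl

-- The algorithms

-- Natural arrays 0 to 4 and rational array 0 are the input, cell 0 of rational
-- array 1 is the output.
control sources targets inA inX node table outcome live counter digits reached extended rounds : ℕ
control  = 0
sources  = 1
targets  = 2
inA      = 3
inX      = 4
node     = 5
table    = 6
outcome  = 7
live     = 8
counter  = 9
digits   = 10
reached  = 11
extended = 12
rounds   = 13

weights result total weight : ℕ
weights = 0
result  = 1
total   = 2
weight  = 3

varᵣ : ℕ → RatExp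
varᵣ a = get a (lit 0)

-- Entry `k` of `table` becomes `outcomes k`. Naturals cannot be multiplied here, so doubling is an
-- addition.
tabulateOutcome : Program
tabulateOutcome =
  (ifᵖ get weights (var counter) ≺ᵣ lit 1ℚ
   then set table (var counter ⊕ lit 1) (get table (var counter) ⊕ get table (var counter))
   else set table (var counter ⊕ lit 1) (get table (var counter))) ⨾
  set counter (lit 0) (var counter ⊕ lit 1)

tabulateOutcomes : Program
tabulateOutcomes =
  set table (lit 0) (lit 1) ⨾
  set counter (lit 0) (lit 0) ⨾
  while var counter ≺ get control (lit 1) run tabulateOutcome

-- Binary expansion from the last coin down: `digits` still encodes the coins to come, and `weight`
-- collects the factors of the random coins already decoded.
decodeCoin : Program
decodeCoin =
  ifᵖ get weights (var counter) ≺ᵣ lit 1ℚ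
  then (ifᵖ var digits ≺ get table (var counter)
        then (set live (var counter) (lit 0) ⨾
              setᵣ weight (lit 0) (varᵣ weight ⊗ (lit 1ℚ ⊕ lit (ℚ.- 1ℚ) ⊗ get weights (var counter))))
        else (set live (var counter) (lit 1) ⨾
              setᵣ weight (lit 0) (varᵣ weight ⊗ get weights (var counter)) ⨾
              set digits (lit 0) (var digits ⊖ get table (var counter))))
  else set live (var counter) (lit 1)

decodeOutcome : Program
decodeOutcome =
  set digits (lit 0) (var outcome) ⨾
  setᵣ weight (lit 0) (lit 1ℚ) ⨾
  set counter (lit 0) (get control (lit 1)) ⨾
  countdown counter decodeCoin

-- Both cells hold 0 or 1, so the sum exceeds 1 exactly if both are set. Reading `reached` but
-- writing `extended` prevents a mark from travelling along several arcs in one round.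
followArc : Program
followArc =
  ifᵖ lit 1 ≺ get live (var counter) ⊕ get reached (get sources (var counter))
  then set extended (get targets (var counter)) (lit 1)
  else skip

playRound : Program
playRound =
  set counter (lit 0) (var control) ⨾
  countdown counter (set reached (var counter) (get extended (var counter))) ⨾
  set counter (lit 0) (get control (lit 1)) ⨾
  countdown counter followArc

simulate : Program
simulate =
  set counter (lit 0) (var control) ⨾
  countdown counter (set extended (var counter) (get inX (var counter))) ⨾
  set rounds (lit 0) (var control) ⨾
  countdown rounds playRound

addOutcome : Program
addOutcome =
  decodeOutcome ⨾
  simulate ⨾
  ifᵖ lit 0 ≺ get extended (var node)
  then setᵣ total (lit 0) (varᵣ total ⊕ varᵣ weight)
  else skip

nodeProbability : Program
nodeProbability =
  tabulateOutcomes ⨾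
  setᵣ total (lit 0) (lit 0ℚ) ⨾
  set outcome (lit 0) (get table (get control (lit 1))) ⨾
  countdown outcome addOutcome

-- Node sets as arrays, and the running times

-- The disjunction pins the cells to 0 and 1 and also decides `P`, so proofs can split on whether a
-- node is reached.
record Marks {n} (f : ℕ → ℕ) (P : Fin n → Set) : Set where
  field
    mark : ∀ v → (P v × f (toℕ v) ≡ 1) ⊎ (¬ P v × f (toℕ v) ≡ 0)

open Marks

marks-⇔ : ∀ {n f} {P Q : Fin n → Set} → (∀ {v} → P v → Q v) → (∀ {v} → Q v → P v) → Marks f P → Marks f Q
marks-⇔ to from marks .mark v with marks .mark v
... | inj₁ (p , eq)  = inj₁ (to p , eq)
... | inj₂ (¬p , eq) = inj₂ (¬p ∘ from , eq)

marks-set : ∀ {n f c} {P : Fin n → Set} u → c ≡ toℕ u → Marks f P → Marks (f [ c ≔ 1 ]) (λ v → P v ⊎ u ≡ v)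
marks-set {f = f} u refl marks .mark v with toℕ v ℕ.≟ toℕ u
... | yes v≡u = inj₁ (inj₂ (sym (Fin.toℕ-injective v≡u)) ,
      subst (λ i → (f [ toℕ u ≔ 1 ]) i ≡ 1) (sym v≡u) (≔-same f (toℕ u) 1))
... | no  v≢u with marks .mark v
...   | inj₁ (p , eq)  = inj₁ (inj₁ p , trans (≔-other f 1 v≢u) eq)
...   | inj₂ (¬p , eq) = inj₂ ([ ¬p , (λ u≡v → v≢u (cong toℕ (sym u≡v))) ]′ , trans (≔-other f 1 v≢u) eq)

marks-bit⁺ : ∀ {n f} {P : Fin n → Set} (P? : ∀ v → Dec (P v)) → (∀ v → f (toℕ v) ≡ bit (does (P? v))) → Marks f P
marks-bit⁺ P? f≡ .mark v with P? v | f≡ v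
... | yes p | eq = inj₁ (p , eq)
... | no ¬p | eq = inj₂ (¬p , eq)

marks-bit⁻ : ∀ {n f} {P : Fin n → Set} v (P? : Dec (P v)) → Marks f P → f (toℕ v) ≡ bit (does P?)
marks-bit⁻ v P? marks with P? | marks .mark v
... | yes _ | inj₁ (_ , eq)  = eq
... | yes p | inj₂ (¬p , _)  = contradiction p ¬p
... | no ¬p | inj₁ (p , _)   = contradiction p ¬p
... | no _  | inj₂ (_ , eq)  = eq

marks-cong : ∀ {n f g} {P : Fin n → Set} → (∀ (v : Fin n) → f (toℕ v) ≡ g (toℕ v)) → Marks g P → Marks f P
marks-cong f≡g marks .mark v with marks .mark v
... | inj₁ (p , eq)  = inj₁ (p , trans (f≡g v) eq)
... | inj₂ (¬p , eq) = inj₂ (¬p , trans (f≡g v) eq)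

copy-step : ∀ {n k c x f} {g : ℕ → ℕ} → k < n → c ≡ k → x ≡ g k →
  (∀ (v : Fin n) → suc k ≤ toℕ v → f (toℕ v) ≡ g (toℕ v)) →
  ∀ (v : Fin n) → k ≤ toℕ v → (f [ c ≔ x ]) (toℕ v) ≡ g (toℕ v)
copy-step {k = k} {f = f} {g} k<n refl refl copied v k≤v with toℕ v ℕ.≟ k
... | yes v≡k = subst (λ i → (f [ k ≔ g k ]) i ≡ g i) (sym v≡k) (≔-same f k (g k))
... | no  v≢k = trans (≔-other f (g k) v≢k) (copied v (ℕ.≤∧≢⇒< k≤v (v≢k ∘ sym)))

-- The sums are nested as the program logic nests them and so agree with the derived bounds by
-- computation. The numerals are costs of assignments and loop tests and, for the 13 in
-- `addOutcomeTime`, of the closing conditional.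
tabulateTime decodeTime : ℕ → ℕ
tabulateTime m = 6 + (m * (6 + worst tabulateOutcome) + 6)
decodeTime   m = 4 + (3 + (4 + (m * (11 + worst decodeCoin) + 5)))

playRoundTime simulateTime addOutcomeTime : ℕ → ℕ → ℕ
playRoundTime  n m = 4 + ((n * (11 + 6) + 5) + (4 + (m * (11 + worst followArc) + 5)))
simulateTime   n m = 4 + ((n * (11 + 6) + 5) + (4 + (n * (11 + playRoundTime n m) + 5)))
addOutcomeTime n m = decodeTime m + (simulateTime n m + 13)

nodeTime : ℕ → ℕ → ℕ → ℕ
nodeTime n m N = tabulateTime m + (3 + (5 + (N * (11 + addOutcomeTime n m) + 5)))

-- The arrays that nodeProbability leaves unchanged.
record Frame : Set where
  field
    control′ sources′ targets′ inA′ inX′ node′ : ℕ → ℕ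
    weights′ result′ : ℕ → ℚ

open Frame

frame : Store → Frame
frame σ = record
  { control′ = nat σ control ; sources′ = nat σ sources ; targets′ = nat σ targets
  ; inA′ = nat σ inA ; inX′ = nat σ inX ; node′ = nat σ node
  ; weights′ = rat σ weights ; result′ = rat σ result }

-- Correctness and running time of the probability computation

module _ {n : ℕ} (G : InfluenceGraph n) (X : Subset n) where
  open InfluenceGraph G
  open LiveEdges G

  -- A statement about arrays, not about a store: it then survives writes to other
  -- arrays by computation.
  record Encodes (ctl srcs tgts mem : ℕ → ℕ) (wts : ℕ → ℚ) : Set where
    field
      nodes    : ctl 0 ≡ n
      arcs     : ctl 1 ≡ m
      sources≡ : ∀ e → srcs (toℕ e) ≡ toℕ (src e)
      targets≡ : ∀ e → tgts (toℕ e) ≡ toℕ (tgt e)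
      inX≡     : ∀ u → mem (toℕ u) ≡ bit (does (u ∈? X))
      weights≡ : ∀ k → wts k ≡ coin k

  EncodedBy : Frame → Set
  EncodedBy φ = Encodes (control′ φ) (sources′ φ) (targets′ φ) (inX′ φ) (weights′ φ)

  module _ {v : Fin n} {φ : Frame} (encodes : EncodedBy φ) (node≡ : node′ φ 0 ≡ toℕ v) where
    open Encodes encodes

    Table : ℕ → (ℕ → ℕ) → Set
    Table i f = ∀ k → k ≤ i → f k ≡ outcomes k

    table-step : ∀ {i f c x} → Table i f → c ≡ suc i → x ≡ outcomes (suc i) → Table (suc i) (f [ c ≔ x ])
    table-step {i} {f} {x = x} t refl refl k k≤ with k ℕ.≟ suc i
    ... | yes refl = ≔-same f (suc i) x
    ... | no  k≢   = trans (≔-other f x k≢) (t k (ℕ.≤-pred (ℕ.≤∧≢⇒< k≤ k≢)))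

    run-tabulateOutcomes : ∀ {σ} → frame σ ≡ φ →
      Runs tabulateOutcomes σ (tabulateTime m) (λ σ′ → frame σ′ ≡ φ × Table m (nat σ′ table))
    run-tabulateOutcomes fr = run-⨾ (run-set (run-⨾ (run-set (mono
      (run-while Inv (λ {k} {σ} → body {k} {σ}) (λ {σ} → exit {σ}) (0 , refl , refl , fr , λ { zero z≤n → refl }))
      λ (i , i+0≡m , _ , fr′ , t) → fr′ , subst (λ i → Table i _) (trans (sym (ℕ.+-identityʳ i)) i+0≡m) t))))
      where
      -- This loop counts up, so the number `d` of iterations to come is tied to the counter by
      -- `i + d ≡ m`.
      Inv : ℕ → Store → Set
      Inv d σ = ∃[ i ] (i + d ≡ m × nat σ counter 0 ≡ i × frame σ ≡ φ × Table i (nat σ table))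

      test : ∀ {σ i} → nat σ counter 0 ≡ i → frame σ ≡ φ → ⟦ var counter ≺ get control (lit 1) ⟧ₜ σ ≡ does (i ℕ.<? m)
      test ctr fr = cong₂ (λ a b → does (a ℕ.<? b)) ctr (trans (cong (λ φ → control′ φ 1) fr) arcs)

      exit : ∀ {σ} → Inv 0 σ → ⟦ var counter ≺ get control (lit 1) ⟧ₜ σ ≡ false
      exit {σ} (i , i+0≡m , ctr , fr , t) = trans (test {σ} ctr fr)
        (dec-false (i ℕ.<? m) λ i<m → ℕ.<-irrefl (trans (sym (ℕ.+-identityʳ i)) i+0≡m) i<m)

      body : ∀ {d σ} → Inv (suc d) σ → ⟦ var counter ≺ get control (lit 1) ⟧ₜ σ ≡ true ×
        Runs tabulateOutcome σ (worst tabulateOutcome) (Inv d)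
      body {d} {σ} (i , i+1+d≡m , ctr , fr , t) =
        trans (test {σ} ctr fr) (dec-true (i ℕ.<? m) (subst (i <_) i+1+d≡m (ℕ.m<m+n i (s≤s z≤n)))) ,
        run-⨾ (run-if
          (λ eq → run-set (run-set (suc i , trans (sym (ℕ.+-suc i d)) i+1+d≡m , ctr+1 , fr ,
            table-step t ctr+1 (trans (cong₂ _+_ entry entry) (sym (outcomes-random i (trans is-random eq)))))))
          (λ eq → run-set (run-set (suc i , trans (sym (ℕ.+-suc i d)) i+1+d≡m , ctr+1 , fr ,
            table-step t ctr+1 (trans entry (sym (outcomes-certain i (trans is-random eq))))))))
        where
        ctr+1 : nat σ counter 0 + 1 ≡ suc i
        ctr+1 = trans (cong (_+ 1) ctr) (ℕ.+-comm i 1)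
        entry : nat σ table (nat σ counter 0) ≡ outcomes i
        entry = trans (cong (nat σ table) ctr) (t i ℕ.≤-refl)
        is-random : random i ≡ does (rat σ weights (nat σ counter 0) ℚ.<? 1ℚ)
        is-random = cong (λ q → does (q ℚ.<? 1ℚ))
          (sym (trans (cong (λ φ → weights′ φ (nat σ counter 0)) fr) (trans (weights≡ _) (cong coin ctr))))

    -- Outcome j is being processed, and the outcomes processed before it contributed a.
    record Outer (j : ℕ) (a : ℚ) (φ′ : Frame) (tab now : ℕ → ℕ) (acc : ℕ → ℚ) : Set where
      field
        kept   : φ′ ≡ φ
        tabled : Table m tab
        now≡   : now 0 ≡ j
        acc≡   : acc 0 ≡ a

      input : ∀ {A : Set} (f : Frame → A) → f φ′ ≡ f φ
      input f = cong f kept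

    AtOuter : ℕ → ℚ → Store → Set
    AtOuter j a σ = Outer j a (frame σ) (nat σ table) (nat σ outcome) (rat σ total)

    module _ (j : ℕ) (a : ℚ) where

      -- Invariant of the decoding: the coins from `k` on are settled and their factors are in `s`,
      -- while the remainder `d` encodes the coins of outcome `j` below `k`.
      Digits : ℕ → (ℕ → ℕ) → ℕ → ℚ → Set
      Digits k f d s =
        d < outcomes k × s ℚ.* chance k d ≡ chance m j ×
        (∀ i → i < k → coins k d i ≡ coins m j i) ×
        (∀ i → k ≤ i → i < m → f i ≡ bit (coins m j i))

      digits-step : ∀ {k b q y f d s c y′ s′} → Digits (suc k) f d s → Leading k d b q y →
        c ≡ k → y′ ≡ y → s′ ≡ s ℚ.* q → Digits k (f [ c ≔ bit b ]) y′ s′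
      digits-step {k} {b} {q} {y} {f} {d} {s} (d< , chance≡ , low , high) (y< , chance′ , coins≡) refl refl refl =
        y< ,
        trans (ℚ.*-assoc s q _) (trans (cong (s ℚ.*_) (sym chance′)) chance≡) ,
        (λ i i<k → trans (sym (trans (cong (λ ω → ω i) coins≡) (≔-other (coins k y) b (ℕ.<⇒≢ i<k))))
          (low i (ℕ.m<n⇒m<1+n i<k))) ,
        high′
        where
        high′ : ∀ i → k ≤ i → i < m → (f [ k ≔ bit b ]) i ≡ bit (coins m j i)
        high′ i k≤i i<m with i ℕ.≟ k
        ... | yes refl = trans (≔-same f k (bit b)) (cong bit (trans
              (sym (trans (cong (λ ω → ω k) coins≡) (≔-same (coins k y) k b))) (low k ℕ.≤-refl)))
        ... | no  i≢k  = trans (≔-other f (bit b) i≢k) (high i (ℕ.≤∧≢⇒< k≤i (i≢k ∘ sym)) i<m)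

      Decoded : Store → Set
      Decoded σ = AtOuter j a σ × (∀ i → i < m → nat σ live i ≡ bit (coins m j i)) ×
        rat σ weight 0 ≡ chance m j

      run-decodeOutcome : ∀ {σ} → j < outcomes m → AtOuter j a σ →
        Runs decodeOutcome σ (decodeTime m) Decoded
      run-decodeOutcome {σ} j< outer = run-⨾ (run-set (run-⨾ (run-setᵣ (run-⨾ (run-set (mono
        (run-countdown counter Inv body (trans (input λ φ → control′ φ 1) arcs)
          (ℕ.≤-refl , outer , subst (λ d → Digits m (nat σ live) d 1ℚ) (sym now≡)
            (j< , ℚ.*-identityˡ _ , (λ _ _ → refl) , λ i m≤i i<m → contradiction i<m (ℕ.≤⇒≯ m≤i))))
        λ (_ , outer′ , _ , chance≡ , _ , high) →
          outer′ , (λ i → high i z≤n) , trans (sym (ℚ.*-identityʳ _)) chance≡))))))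
        where
        open Outer outer
        Inv : ℕ → Store → Set
        Inv k σ = k ≤ m × AtOuter j a σ × Digits k (nat σ live) (nat σ digits 0) (rat σ weight 0)

        body : Iteration counter decodeCoin (worst decodeCoin) Inv
        body {k} {σ} (1+k≤m , outer′ , ds@(d< , _)) ctr = run-if
          (λ eq → run-if
            (λ d≺ → run-⨾ (run-set (run-setᵣ (ctr , k≤m , outer′ ,
              step′ false (1ℚ ℚ.- coin k) d (leading-false k (trans is-random eq) (below d≺)) refl
                (cong (s ℚ.*_) (trans (complement (rat σ weights (nat σ counter 0 ∸ 1))) (cong (λ q → 1ℚ ℚ.- q) coin≡)))))))
            (λ d⊀ → run-⨾ (run-set (run-⨾ (run-setᵣ (run-set (ctr , k≤m , outer′ ,
              step′ true (coin k) (d ∸ outcomes k) (leading-true k d< (trans is-random eq) (above d⊀)) (cong (d ∸_) entry)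
                (cong (s ℚ.*_) coin≡))))))))
          (λ eq → run-set (ctr , k≤m , outer′ ,
            step′ true 1ℚ d (leading-certain k d< (trans is-random eq)) refl (sym (ℚ.*-identityʳ s))))
          where
          d = nat σ digits 0
          s = rat σ weight 0
          step′ : ∀ b q y {y′ s′} → Leading k d b q y → y′ ≡ y → s′ ≡ s ℚ.* q →
            Digits k (nat σ live [ nat σ counter 0 ∸ 1 ≔ bit b ]) y′ s′
          step′ b q y leading y′≡ s′≡ = digits-step {b = b} {q} {y} {nat σ live} {d} {s} ds leading ctr y′≡ s′≡
          k≤m : k ≤ m
          k≤m = ℕ.<⇒≤ 1+k≤m
          coin≡ : rat σ weights (nat σ counter 0 ∸ 1) ≡ coin k
          coin≡ = trans (Outer.input outer′ λ φ → weights′ φ (nat σ counter 0 ∸ 1))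
            (trans (weights≡ _) (cong coin ctr))
          entry : nat σ table (nat σ counter 0 ∸ 1) ≡ outcomes k
          entry = trans (cong (nat σ table) ctr) (Outer.tabled outer′ k k≤m)
          is-random : random k ≡ does (rat σ weights (nat σ counter 0 ∸ 1) ℚ.<? 1ℚ)
          is-random = cong (λ q → does (q ℚ.<? 1ℚ)) (sym coin≡)
          below : does (nat σ digits 0 ℕ.<? nat σ table (nat σ counter 0 ∸ 1)) ≡ true →
            nat σ digits 0 < outcomes k
          below eq = does-true (_ ℕ.<? _) (trans (cong (λ x → does (nat σ digits 0 ℕ.<? x)) (sym entry)) eq)
          above : does (nat σ digits 0 ℕ.<? nat σ table (nat σ counter 0 ∸ 1)) ≡ false →
            ¬ nat σ digits 0 < outcomes k
          above eq = does-false (_ ℕ.<? _) (trans (cong (λ x → does (nat σ digits 0 ℕ.<? x)) (sym entry)) eq)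

      coinsⱼ : Coins
      coinsⱼ = coins m j

      Reached : ℕ → Fin n → Set
      Reached = Reach coinsⱼ X

      record Fixed (φ′ : Frame) (tab now lives : ℕ → ℕ) (acc wgt : ℕ → ℚ) : Set where
        field
          outer  : Outer j a φ′ tab now acc
          lives≡ : ∀ i → i < m → lives i ≡ bit (coinsⱼ i)
          wgt≡   : wgt 0 ≡ chance m j

        open Outer outer public

      AtFixed : Store → Set
      AtFixed σ = Fixed (frame σ) (nat σ table) (nat σ outcome) (nat σ live) (rat σ total) (rat σ weight)

      -- Arcs are inspected from the last to the first. This interpolates between `Reached t` at
      -- `k = m` and `Reached (suc t)` at `k = 0`.
      FollowedFrom : ℕ → ℕ → Fin n → Set
      FollowedFrom t k v =
        Reached t v ⊎ ∃[ e ] (k ≤ toℕ e × coinsⱼ (toℕ e) ≡ true × Reached t (src e) × tgt e ≡ v)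

      FollowedFrom-0 : ∀ {t v} → FollowedFrom t 0 v → Reached (suc t) v
      FollowedFrom-0 (inj₁ r)                              = stay r
      FollowedFrom-0 (inj₂ (e , _ , live-e , r , refl))    = arc e live-e r

      FollowedFrom-0⁻ : ∀ {t v} → Reached (suc t) v → FollowedFrom t 0 v
      FollowedFrom-0⁻ (stay r)         = inj₁ r
      FollowedFrom-0⁻ (arc e live-e r) = inj₂ (e , z≤n , live-e , r , refl)

      run-followArcs : ∀ {σ t l} → nat σ counter 0 ≡ m → nat σ rounds 0 ≡ l → AtFixed σ →
        Marks (nat σ reached) (Reached t) → Marks (nat σ extended) (Reached t) →
        Runs (countdown counter followArc) σ (m * (11 + worst followArc) + 5)
          (λ σ′ → nat σ′ rounds 0 ≡ l × AtFixed σ′ × Marks (nat σ′ extended) (Reached (suc t)))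
      run-followArcs {t = t} {l} ctr rnd fixed old new = mono
        (run-countdown counter Inv body ctr (ℕ.≤-refl , rnd , fixed , old ,
          marks-⇔ inj₁ (λ { (inj₁ r) → r ; (inj₂ (e , m≤e , _)) → contradiction (Fin.toℕ<n e) (ℕ.≤⇒≯ m≤e) }) new))
        (λ (_ , rnd′ , fixed′ , _ , new′) → rnd′ , fixed′ , marks-⇔ FollowedFrom-0 FollowedFrom-0⁻ new′)
        where
        Inv : ℕ → Store → Set
        Inv k σ = k ≤ m × nat σ rounds 0 ≡ l × AtFixed σ × Marks (nat σ reached) (Reached t) ×
          Marks (nat σ extended) (FollowedFrom t k)

        body : Iteration counter followArc (worst followArc) Inv
        body {k} {σ} (k<m , rnd , fixed , old , new) ctr = run-if
          (λ eq → run-set (ctr , ℕ.<⇒≤ k<m , rnd , fixed , old ,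
            marks-⇔ (to eq) (from (proj₁ (both eq)) (proj₂ (both eq))) (marks-set (tgt e) target new)))
          (λ eq → run-skip (ctr , ℕ.<⇒≤ k<m , rnd , fixed , old ,
            marks-⇔ weaken (strengthen eq) new))
          where
          e : Fin m
          e = fromℕ< k<m
          e≡k : toℕ e ≡ k
          e≡k = Fin.toℕ-fromℕ< k<m
          c : ℕ
          c = nat σ counter 0 ∸ 1
          c≡e : c ≡ toℕ e
          c≡e = trans ctr (sym e≡k)
          target : nat σ targets c ≡ toℕ (tgt e)
          target = trans (Fixed.input fixed λ φ → targets′ φ c) (trans (cong (targets′ φ) c≡e) (targets≡ e))
          source′ : nat σ sources c ≡ toℕ (src e)
          source′ = trans (Fixed.input fixed λ φ → sources′ φ c) (trans (cong (sources′ φ) c≡e) (sources≡ e))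
          alive : nat σ live c ≡ bit (coinsⱼ k)
          alive = trans (cong (nat σ live) ctr) (Fixed.lives≡ fixed k k<m)

          Passes : Bool → Set
          Passes b = does (1 ℕ.<? nat σ live c + nat σ reached (nat σ sources c)) ≡ b

          both : Passes true → coinsⱼ (toℕ e) ≡ true × Reached t (src e)
          both eq rewrite source′ | alive | e≡k with coinsⱼ k | old .mark (src e)
          ... | true  | inj₁ (r , _)  = refl , r
          ... | true  | inj₂ (_ , r≡) = contradiction (trans (sym eq) (cong (λ x → does (1 ℕ.<? 1 + x)) r≡)) λ ()
          ... | false | inj₁ (_ , r≡) = contradiction (trans (sym eq) (cong (λ x → does (1 ℕ.<? x)) r≡)) λ ()
          ... | false | inj₂ (_ , r≡) = contradiction (trans (sym eq) (cong (λ x → does (1 ℕ.<? x)) r≡)) λ ()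

          passes : coinsⱼ (toℕ e) ≡ true → Reached t (src e) → Passes true
          passes live-e r with old .mark (src e)
          ... | inj₂ (¬r , _) = contradiction r ¬r
          ... | inj₁ (_ , r≡) = cong₂ (λ x y → does (1 ℕ.<? x + y))
                (trans alive (cong bit (trans (cong coinsⱼ (sym e≡k)) live-e)))
                (trans (cong (nat σ reached) source′) r≡)

          weaken : ∀ {v} → FollowedFrom t (suc k) v → FollowedFrom t k v
          weaken (inj₁ r)                = inj₁ r
          weaken (inj₂ (e′ , k<e′ , rest)) = inj₂ (e′ , ℕ.<⇒≤ k<e′ , rest)

          last : ∀ {e′} → k ≤ toℕ e′ → ¬ k < toℕ e′ → e′ ≡ e
          last k≤e′ k≮e′ = Fin.toℕ-injective (trans (ℕ.≤-antisym (ℕ.≮⇒≥ k≮e′) k≤e′) (sym e≡k))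

          to : Passes true → ∀ {v} → FollowedFrom t (suc k) v ⊎ tgt e ≡ v → FollowedFrom t k v
          to eq (inj₁ followed) = weaken followed
          to eq (inj₂ e→v)      = inj₂ (e , ℕ.≤-reflexive (sym e≡k) , proj₁ (both eq) , proj₂ (both eq) , e→v)

          from : coinsⱼ (toℕ e) ≡ true → Reached t (src e) →
            ∀ {v} → FollowedFrom t k v → FollowedFrom t (suc k) v ⊎ tgt e ≡ v
          from live-e r (inj₁ r′) = inj₁ (inj₁ r′)
          from live-e r (inj₂ (e′ , k≤e′ , rest)) with k ℕ.<? toℕ e′
          ... | yes k<e′ = inj₁ (inj₂ (e′ , k<e′ , rest))
          ... | no  k≮e′ with last k≤e′ k≮e′
          ...   | refl = inj₂ (proj₂ (proj₂ rest))

          strengthen : Passes false → ∀ {v} → FollowedFrom t k v → FollowedFrom t (suc k) v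
          strengthen eq (inj₁ r′) = inj₁ r′
          strengthen eq (inj₂ (e′ , k≤e′ , rest@(live-e , r , _))) with k ℕ.<? toℕ e′
          ... | yes k<e′ = inj₂ (e′ , k<e′ , rest)
          ... | no  k≮e′ with last k≤e′ k≮e′
          ...   | refl = contradiction (trans (sym eq) (passes live-e r)) λ ()

      run-playRound : ∀ {σ t l} → nat σ rounds 0 ≡ l → AtFixed σ → Marks (nat σ extended) (Reached t) →
        Runs playRound σ (playRoundTime n m)
          (λ σ′ → nat σ′ rounds 0 ≡ l × AtFixed σ′ × Marks (nat σ′ extended) (Reached (suc t)))
      run-playRound {t = t} {l} rnd fixed new = run-⨾ (run-set
        (run-countdown counter Inv body (trans (Fixed.input fixed λ φ → control′ φ 0) nodes)
          (ℕ.≤-refl , rnd , fixed , new , λ v n≤v → contradiction (Fin.toℕ<n v) (ℕ.≤⇒≯ n≤v))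
        ⨟ λ (_ , rnd′ , fixed′ , new′ , copied) → run-⨾ (run-set
          (run-followArcs (trans (Fixed.input fixed′ λ φ → control′ φ 1) arcs) rnd′ fixed′
            (marks-cong (λ v → copied v z≤n) new′) new′))))
        where
        Inv : ℕ → Store → Set
        Inv k σ = k ≤ n × nat σ rounds 0 ≡ l × AtFixed σ × Marks (nat σ extended) (Reached t) ×
          (∀ (v : Fin n) → k ≤ toℕ v → nat σ reached (toℕ v) ≡ nat σ extended (toℕ v))

        body : Iteration counter (set reached (var counter) (get extended (var counter))) 6 Inv
        body {k} {σ} (k<n , rnd , fixed , new , copied) ctr = run-set (ctr , ℕ.<⇒≤ k<n , rnd , fixed , new ,
          copy-step {f = nat σ reached} k<n ctr (cong (nat σ extended) ctr) copied)

      run-simulate : ∀ {σ} → AtFixed σ →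
        Runs simulate σ (simulateTime n m) (λ σ′ → AtFixed σ′ × Marks (nat σ′ extended) (Reached n))
      run-simulate fixed = run-⨾ (run-set
        (run-countdown counter Copied copyBody (trans (Fixed.input fixed λ φ → control′ φ 0) nodes)
          (ℕ.≤-refl , fixed , λ v n≤v → contradiction (Fin.toℕ<n v) (ℕ.≤⇒≯ n≤v))
        ⨟ λ {σ} (_ , fixed′ , copied) → run-⨾ (run-set
          (mono
            (run-countdown rounds Inv body (trans (Fixed.input fixed′ λ φ → control′ φ 0) nodes)
              (0 , refl , fixed′ , marks-⇔ source (λ { (source v∈) → v∈ }) (marks-bit⁺ (_∈? X) λ v →
                trans (copied v z≤n) (trans (Fixed.input fixed′ λ φ → inX′ φ (toℕ v)) (inX≡ v)))))
            (λ (t , t+0≡n , fixed″ , new) → fixed″ ,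
              subst (λ t → Marks _ (Reached t)) (trans (sym (ℕ.+-identityʳ t)) t+0≡n) new)))))
        where
        Copied : ℕ → Store → Set
        Copied k σ = k ≤ n × AtFixed σ ×
          (∀ (v : Fin n) → k ≤ toℕ v → nat σ extended (toℕ v) ≡ nat σ inX (toℕ v))

        copyBody : Iteration counter (set extended (var counter) (get inX (var counter))) 6 Copied
        copyBody {k} {σ} (k<n , fixed , copied) ctr = run-set (ctr , ℕ.<⇒≤ k<n , fixed ,
          copy-step {f = nat σ extended} k<n ctr (cong (nat σ inX) ctr) copied)

        Inv : ℕ → Store → Set
        Inv k σ = ∃[ t ] (t + k ≡ n × AtFixed σ × Marks (nat σ extended) (Reached t))

        body : Iteration rounds playRound (playRoundTime n m) Inv
        body {k} {σ} (t , t+1+k≡n , fixed , new) ctr = mono (run-playRound ctr fixed new)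
          λ (ctr′ , fixed′ , new′) → ctr′ , suc t , trans (sym (ℕ.+-suc t k)) t+1+k≡n , fixed′ , new′

      activated : Bool
      activated = does (v ∈? active (state coinsⱼ X n))

      run-addOutcome : ∀ {σ} → j < outcomes m → AtOuter j a σ →
        Runs addOutcome σ (addOutcomeTime n m) (AtOuter j (a ℚ.+ chance m j ℚ.* ind activated))
      run-addOutcome j< outer = run-decodeOutcome j< outer ⨟ λ (outer′ , lives , wgt) →
        run-simulate record { outer = outer′ ; lives≡ = lives ; wgt≡ = wgt } ⨟ λ {σ} (fixed , new) →
        let open Fixed fixed
            entry : nat σ extended (nat σ node 0) ≡ bit activated
            entry = trans (cong (nat σ extended) (trans (input λ φ → node′ φ 0) node≡))
              -- Here the machine meets the process: the marks after `n` rounds describe the active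
              -- set at time `n`.
              (marks-bit⁻ v (v ∈? active (state coinsⱼ X n))
                (marks-⇔ (reach-⇒ coinsⱼ X n) (reach-⇐ coinsⱼ X n) new))
            test : does (0 ℕ.<? nat σ extended (nat σ node 0)) ≡ activated
            test = trans (cong (λ x → does (0 ℕ.<? x)) entry) (positive-bit activated)
        in run-if
          (λ eq → run-setᵣ record { kept = kept ; tabled = tabled ; now≡ = now≡ ; acc≡ =
            cong₂ ℚ._+_ acc≡ (trans wgt≡ (trans (sym (ℚ.*-identityʳ _))
              (cong (λ b → chance m j ℚ.* ind b) (trans (sym eq) test)))) })
          (λ eq → run-skip record { kept = kept ; tabled = tabled ; now≡ = now≡ ; acc≡ =
            trans acc≡ (trans (sym (ℚ.+-identityʳ a)) (cong (a ℚ.+_) (trans (sym (ℚ.*-zeroʳ (chance m j)))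
              (cong (λ b → chance m j ℚ.* ind b) (trans (sym eq) test))))) })

    run-nodeProbability : ∀ {σ} → frame σ ≡ φ →
      Runs nodeProbability σ (nodeTime n m (2 ^ r)) (λ σ′ → frame σ′ ≡ φ × rat σ′ total 0 ≡ p G X v)
    run-nodeProbability fr = run-tabulateOutcomes fr ⨟ λ {σ} (fr′ , tab) → run-⨾ (run-setᵣ (run-⨾ (run-set (mono
      (run-countdown outcome Inv body
        (trans (cong (nat σ table) (trans (cong (λ φ → control′ φ 1) fr′) arcs)) (trans (tab m ℕ.≤-refl) outcomes-m))
        (ℕ.≤-refl , fr′ , tab , ℚ.+-identityˡ _))
      λ (_ , fr″ , _ , acc≡) → fr″ ,
        trans (sym (ℚ.+-identityʳ _)) (trans acc≡ (sym (probability X v)))))))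
      where
      summand : ℕ → ℚ
      summand j = chance m j ℚ.* ind (does (v ∈? active (state (coins m j) X n)))

      -- What has been added plus what is still to come equals the full sum; at `k = 0` nothing is
      -- to come.
      Inv : ℕ → Store → Set
      Inv k σ = k ≤ 2 ^ r × frame σ ≡ φ × Table m (nat σ table) ×
        rat σ total 0 ℚ.+ sum k summand ≡ sum (2 ^ r) summand

      body : Iteration outcome addOutcome (addOutcomeTime n m) Inv
      body {k} {σ} (k< , fr , tab , acc≡) ctr = mono
        (run-addOutcome k (rat σ total 0) (subst (k <_) (sym outcomes-m) k<)
          record { kept = fr ; tabled = tab ; now≡ = ctr ; acc≡ = refl })
        λ outer → let open Outer outer renaming (acc≡ to acc′≡) in
          now≡ , ℕ.<⇒≤ k< , kept , tabled ,
          trans (cong (ℚ._+ sum k summand) acc′≡) (trans (ℚ.+-assoc (rat σ total 0) (summand k) (sum k summand)) acc≡)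

-- The two algorithms on encoded instances

nodeAlgorithm : Program
nodeAlgorithm =
  set node (lit 0) (get control (lit 2)) ⨾
  nodeProbability ⨾
  setᵣ result (lit 0) (varᵣ total)

addNode : Program
addNode =
  ifᵖ lit 0 ≺ get inA (var node)
  then setᵣ result (lit 0) (varᵣ result ⊕ (lit 1ℚ ⊕ lit (ℚ.- 1ℚ) ⊗ varᵣ total))
  else setᵣ result (lit 0) (varᵣ result ⊕ varᵣ total)

-- `node` is both the loop counter and the query: the countdown leaves the next node in it, and
-- `nodeProbability` preserves it together with the cost accumulated in `result`.
costAlgorithm : Program
costAlgorithm =
  set node (lit 0) (var control) ⨾
  countdown node (nodeProbability ⨾ addNode)

runs⇒halts : ∀ {P σ T q U} → Runs P σ T (λ σ′ → output σ′ ≡ q) → T ≤ U →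
  ∃[ σ′ ] ∃[ t ] (⟨ P , σ ⟩⇓⟨ σ′ , t ⟩ × output σ′ ≡ q × t ≤ U)
runs⇒halts (runs e t≤ q) T≤ = _ , _ , e , q , ℕ.≤-trans t≤ T≤

module Instance (I : EffectorsInstance) where
  open EffectorsInstance I using (n; G; A; X; m; r)
  open InfluenceGraph G using (src; tgt; w)

  EncodedIn : Store → Set
  EncodedIn σ = EncodedBy G X (frame σ)

  encoded : ∀ q → EncodedIn (encodeWith I q)
  encoded q = record
    { nodes    = refl
    ; arcs     = refl
    ; sources≡ = tabulated-toℕ 0 (λ e → toℕ (src e))
    ; targets≡ = tabulated-toℕ 0 (λ e → toℕ (tgt e))
    ; inX≡     = tabulated-toℕ 0 (λ v → bit (does (v ∈? X)))
    ; weights≡ = λ _ → refl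
    }

  run-nodeAlgorithm : ∀ v → Runs nodeAlgorithm (encodeWith I (toℕ v)) (4 + (nodeTime n m (2 ^ r) + 4))
    (λ σ → output σ ≡ p G X v)
  run-nodeAlgorithm v = run-⨾ (run-set (run-nodeProbability G X (encoded (toℕ v)) refl refl
    ⨟ λ (_ , total≡) → run-setᵣ total≡))

  term : Fin n → ℚ
  term v = if does (v ∈? A) then 1ℚ ℚ.- p G X v else p G X v

  -- The algorithm makes one pass over all nodes, whereas `C` sums over `A` and its complement
  -- separately; each node passes exactly one of the two filters.
  foldr-split : ∀ (f g : Fin n → ℚ) vs →
    foldr ℚ._+_ 0ℚ (map f (filter (_∈? A) vs)) ℚ.+ foldr ℚ._+_ 0ℚ (map g (filter (_∈? ∁ A) vs)) ≡
    foldr ℚ._+_ 0ℚ (map (λ v → if does (v ∈? A) then f v else g v) vs)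
  foldr-split f g [] = refl
  foldr-split f g (v ∷ vs) with foldr-split f g vs | v ∈? A | v ∈? ∁ A
  ... | ih | yes v∈ | yes v∈∁ = contradiction v∈ (x∈∁p⇒x∉p v∈∁)
  ... | ih | no  v∉ | no  v∉∁ = contradiction (x∉p⇒x∈∁p v∉) v∉∁
  ... | ih | yes _  | no  _   = trans (ℚ.+-assoc (f v) _ _) (cong (f v ℚ.+_) ih)
  ... | ih | no  _  | yes _   = trans
    (solve 3 (λ a b c → a :+ (b :+ c) := b :+ (a :+ c)) refl (foldr ℚ._+_ 0ℚ (map f (filter (_∈? A) vs))) (g v) _)
    (cong (g v ℚ.+_) ih)

  cost-sum : C G A X ≡ sum n (tabulated 0ℚ term)
  cost-sum = trans (foldr-split (λ v → 1ℚ ℚ.- p G X v) (p G X) (allFin n))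
    (sum-allFin term id (tabulated 0ℚ term) (tabulated-toℕ 0ℚ term))

  run-costAlgorithm : Runs costAlgorithm (encodeWith I 0)
    (4 + (n * (11 + (nodeTime n m (2 ^ r) + worst addNode)) + 5)) (λ σ → output σ ≡ C G A X)
  run-costAlgorithm = run-⨾ (run-set (mono
    (run-countdown node Inv body refl
      (ℕ.≤-refl , encoded 0 , tabulated-toℕ 0 (λ v → bit (does (v ∈? A))) , ℚ.+-identityˡ _))
    λ (_ , _ , _ , acc≡) → trans (sym (ℚ.+-identityʳ _)) (trans acc≡ (sym cost-sum))))
    where
    Inv : ℕ → Store → Set
    Inv k σ = k ≤ n × EncodedIn σ × (∀ v → nat σ inA (toℕ v) ≡ bit (does (v ∈? A))) ×
      rat σ result 0 ℚ.+ sum k (tabulated 0ℚ term) ≡ sum n (tabulated 0ℚ term)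

    body : Iteration node (nodeProbability ⨾ addNode) (nodeTime n m (2 ^ r) + worst addNode) Inv
    body {k} {σ} (k<n , enc , inA≡ , acc≡) ctr =
      run-nodeProbability G X {v = v} enc (trans ctr (sym v≡k)) refl ⨟ after
      where
      v : Fin n
      v = fromℕ< k<n
      v≡k : toℕ v ≡ k
      v≡k = Fin.toℕ-fromℕ< k<n

      after : ∀ {σ″} → frame σ″ ≡ frame (decrement node σ) × rat σ″ total 0 ≡ p G X v →
        Runs addNode σ″ (worst addNode) (λ σ‴ → nat σ‴ node 0 ≡ k × Inv k σ‴)
      after {σ″} (fr , total≡) = run-if
        (λ eq → run-setᵣ (ctr′ , ℕ.<⇒≤ k<n , enc′ , inA≡′ , accumulate (trans
          (complement (rat σ″ total 0))
          (trans (cong (λ q → 1ℚ ℚ.- q) total≡) (cong (if_then 1ℚ ℚ.- p G X v else p G X v) (trans (sym eq) test))))))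
        (λ eq → run-setᵣ (ctr′ , ℕ.<⇒≤ k<n , enc′ , inA≡′ , accumulate
          (trans total≡ (cong (if_then 1ℚ ℚ.- p G X v else p G X v) (trans (sym eq) test)))))
        where
        ctr′ : nat σ″ node 0 ≡ k
        ctr′ = trans (cong (λ φ → node′ φ 0) fr) ctr
        enc′ : EncodedIn σ″
        enc′ = subst (EncodedBy G X) (sym fr) enc
        inA≡′ : ∀ u → nat σ″ inA (toℕ u) ≡ bit (does (u ∈? A))
        inA≡′ u = trans (cong (λ φ → inA′ φ (toℕ u)) fr) (inA≡ u)
        test : does (0 ℕ.<? nat σ″ inA (nat σ″ node 0)) ≡ does (v ∈? A)
        test = trans (cong (λ x → does (0 ℕ.<? x)) (trans (cong (nat σ″ inA) (trans ctr′ (sym v≡k))) (inA≡′ v)))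
          (positive-bit _)
        accumulate : ∀ {q} → q ≡ term v →
          rat σ″ result 0 ℚ.+ q ℚ.+ sum k (tabulated 0ℚ term) ≡ sum n (tabulated 0ℚ term)
        accumulate {q} q≡ = trans (ℚ.+-assoc (rat σ″ result 0) q _) (trans
          (cong₂ (λ a b → a ℚ.+ (b ℚ.+ sum k (tabulated 0ℚ term))) (cong (λ φ → result′ φ 0) fr)
            (trans q≡ (trans (sym (tabulated-toℕ 0ℚ term v)) (cong (tabulated 0ℚ term) v≡k))))
          acc≡)

-- The asymptotic bounds

-- Keeping `K` and `S` as separate parameters lets the rules below assemble the constant, so that
-- the witnesses left as `_` are solved from the derivations.
record _≲_⋅_ (t K S : ℕ) : Set where
  constructor bound
  field
    bounded : t ≤ K * S

open _≲_⋅_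

const≲ : ∀ {S} → 1 ≤ S → ∀ k → k ≲ k ⋅ S
const≲ 1≤S k = bound (subst (_≤ k * _) (ℕ.*-identityʳ k) (ℕ.*-monoʳ-≤ k 1≤S))

plus≲ : ∀ {S t u K L} → t ≲ K ⋅ S → u ≲ L ⋅ S → (t + u) ≲ (K + L) ⋅ S
plus≲ {S} {K = K} {L} (bound t≤) (bound u≤) =
  bound (ℕ.≤-trans (ℕ.+-mono-≤ t≤ u≤) (ℕ.≤-reflexive (sym (ℕ.*-distribʳ-+ S K L))))

linear≲ : ∀ {S x} → x ≤ S → ∀ k → (x * k) ≲ k ⋅ S
linear≲ {S} {x} x≤S k = bound (subst (_≤ k * S) (ℕ.*-comm k x) (ℕ.*-monoʳ-≤ k x≤S))

scale≲ : ∀ x {S t K} → t ≲ K ⋅ S → (x * t) ≲ K ⋅ (x * S)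
scale≲ x {S} {t} {K} (bound t≤) = bound (ℕ.≤-trans (ℕ.*-monoʳ-≤ x t≤)
  (ℕ.≤-reflexive (ℕSolver.solve 3 (λ x K S → x ℕSolver.:* (K ℕSolver.:* S) ℕSolver.:= K ℕSolver.:* (x ℕSolver.:* S)) refl x K S)))

widen≲ : ∀ {S S′ t K} → S ≤ S′ → t ≲ K ⋅ S → t ≲ K ⋅ S′
widen≲ {K = K} S≤S′ (bound t≤) = bound (ℕ.≤-trans t≤ (ℕ.*-monoʳ-≤ K S≤S′))

-- With `1 ≤ n`, a term linear in `n + m` is absorbed by `n * (n + m)`. Only the loops over rounds
-- and over outcomes need `scale≲`; the other loops have bodies of constant cost.
nodeTime-bound : ∃[ K ] (∀ n m N → 1 ≤ n → 1 ≤ N → nodeTime n m N ≲ K ⋅ (N * (n * (n + m))))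
nodeTime-bound = _ , λ n m N 1≤n 1≤N →
  let S = n + m
      1≤S : 1 ≤ S
      1≤S = ℕ.≤-trans 1≤n (ℕ.m≤m+n n m)
      n≤S : n ≤ S
      n≤S = ℕ.m≤m+n n m
      m≤S : m ≤ S
      m≤S = ℕ.m≤n+m m n
      S≤nS : S ≤ n * S
      S≤nS = subst (_≤ n * S) (ℕ.*-identityˡ S) (ℕ.*-monoˡ-≤ S 1≤n)
      nS≤NnS : n * S ≤ N * (n * S)
      nS≤NnS = subst (_≤ N * (n * S)) (ℕ.*-identityˡ (n * S)) (ℕ.*-monoˡ-≤ (n * S) 1≤N)
      S≤ = ℕ.≤-trans S≤nS nS≤NnS
      const = const≲ 1≤S
      playRound≲ = plus≲ (const 4) (plus≲ (plus≲ (linear≲ n≤S (11 + 6)) (const 5))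
        (plus≲ (const 4) (plus≲ (linear≲ m≤S (11 + worst followArc)) (const 5))))
      simulate≲ = plus≲ (widen≲ S≤nS (const 4)) (plus≲ (widen≲ S≤nS (plus≲ (linear≲ n≤S (11 + 6)) (const 5)))
        (plus≲ (widen≲ S≤nS (const 4)) (plus≲ (scale≲ n (plus≲ (const 11) playRound≲)) (widen≲ S≤nS (const 5)))))
      decode≲ = plus≲ (const 4) (plus≲ (const 3) (plus≲ (const 4)
        (plus≲ (linear≲ m≤S (11 + worst decodeCoin)) (const 5))))
      addOutcome≲ = plus≲ (widen≲ S≤nS decode≲) (plus≲ simulate≲ (widen≲ S≤nS (const 13)))
      tabulate≲ = plus≲ (const 6) (plus≲ (linear≲ m≤S (6 + worst tabulateOutcome)) (const 6))
  in plus≲ (widen≲ S≤ tabulate≲) (plus≲ (widen≲ S≤ (const 3)) (plus≲ (widen≲ S≤ (const 5))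
       (plus≲ (scale≲ N (plus≲ (widen≲ S≤nS (const 11)) addOutcome≲)) (widen≲ S≤ (const 5)))))

nodeAlgorithmTime-bound : ∃[ K ] (∀ n m N → 1 ≤ n → 1 ≤ N →
  (4 + (nodeTime n m N + 4)) ≲ K ⋅ (1 ⊔ N * (n * (n + m))))
nodeAlgorithmTime-bound = _ , λ n m N 1≤n 1≤N →
  let 1≤D = ℕ.m≤m⊔n 1 (N * (n * (n + m)))
  in plus≲ (const≲ 1≤D 4)
       (plus≲ (widen≲ (ℕ.m≤n⊔m 1 (N * (n * (n + m)))) (proj₂ nodeTime-bound n m N 1≤n 1≤N)) (const≲ 1≤D 4))

costAlgorithmTime-bound : ∃[ K ] (∀ n m N → 1 ≤ N →
  (4 + (n * (11 + (nodeTime n m N + worst addNode)) + 5)) ≲ K ⋅ (1 ⊔ N * (n ^ 2 * (n + m))))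
costAlgorithmTime-bound = _ , λ n m N 1≤N →
  let 1≤D = ℕ.m≤m⊔n 1 (N * (n ^ 2 * (n + m)))
  in plus≲ (const≲ 1≤D 4)
       (plus≲ (widen≲ (ℕ.m≤n⊔m 1 (N * (n ^ 2 * (n + m)))) (iterations n m N 1≤N)) (const≲ 1≤D 5))
  where
  K = 11 + (proj₁ nodeTime-bound + worst addNode)

  iterations : ∀ n m N → 1 ≤ N →
    (n * (11 + (nodeTime n m N + worst addNode))) ≲ K ⋅ (N * (n ^ 2 * (n + m)))
  -- Without nodes the loop makes no iteration, and `nodeTime-bound` would not apply.
  iterations zero      m N 1≤N = bound z≤n
  iterations n@(suc _) m N 1≤N = subst ((n * (11 + (nodeTime n m N + worst addNode))) ≲ K ⋅_)
    (ℕSolver.solve 3 (λ n m N → n ℕSolver.:* (N ℕSolver.:* (n ℕSolver.:* (n ℕSolver.:+ m)))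
      ℕSolver.:= N ℕSolver.:* ((n ℕSolver.:^ 2) ℕSolver.:* (n ℕSolver.:+ m))) refl n m N)
    (scale≲ n
      (plus≲ (const≲ 1≤D 11) (plus≲ (proj₂ nodeTime-bound n m N (s≤s z≤n) 1≤N) (const≲ 1≤D (worst addNode)))))
    where
    1≤D : 1 ≤ N * (n * (n + m))
    1≤D = ℕ.*-mono-≤ 1≤N (ℕ.*-mono-≤ {1} {n} (s≤s z≤n) (s≤s z≤n))

open EffectorsInstance using (n; m; r)

theorem2 : ComputableInTimeO encodeNodeQuery activationProbability
    (λ (I , v) → 2 ^ r I * (n I * (n I + m I)))
    ×
    ComputableInTimeO encode effectorsCost
    (λ I → 2 ^ r I * (n I ^ 2 * (n I + m I)))
theorem2 =
  (nodeAlgorithm , proj₁ nodeAlgorithmTime-bound , λ (I , v) →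
    runs⇒halts (Instance.run-nodeAlgorithm I v)
      -- The queried node itself witnesses `1 ≤ n`.
      (bounded (proj₂ nodeAlgorithmTime-bound (n I) (m I) (2 ^ r I) (ℕ.≤-trans (s≤s z≤n) (Fin.toℕ<n v)) (ℕ.m^n>0 2 (r I))))) ,
  (costAlgorithm , proj₁ costAlgorithmTime-bound , λ I →
    runs⇒halts (Instance.run-costAlgorithm I)
      (bounded (proj₂ costAlgorithmTime-bound (n I) (m I) (2 ^ r I) (ℕ.m^n>0 2 (r I)))))
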